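{- Let $F(x)=\sum_{n\geqslant 0}|\mathcal{I}_n(102,210)|\,x^n$. Then $$F(x)=\frac{(4x-1)(4x^4-22x^3+25x^2-9x+1)-(2x-1)(x^2-5x+1)(2x^2-4x+1)\sqrt{1-4x}}{2x^3(4x-1)(x-1)^2},$$ where $\sqrt{1-4x}$ denotes the formal power series square root with constant term $1$.
   Context: For $n\in\mathbb N$, an inversion sequence of size $n$ is a sequence $\sigma=(\sigma_1,\dots,\sigma_n)\in\mathbb N^n$ with $\sigma_i<i$ for all $i$ (there is one, empty, inversion sequence of size $0$). An integer sequence contains a pattern $\rho$ (a finite integer sequence such as $102$ or $210$) if it has a subsequence order-isomorphic to $\rho$, and avoids $\rho$ otherwise. $\mathcal{I}_n(P)$ denotes the set of inversion sequences of size $n$ avoiding every pattern in $P$. -}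

module Defs where

open import Data.Nat using (ℕ; zero; suc; _<ᵇ_; _≡ᵇ_; _∸_)
open import Data.Bool using (Bool; true; false; _∧_; if_then_else_)
open import Data.Bool.Properties using () renaming (_≟_ to _≟𝔹_)
open import Data.List using (List; []; _∷_; [_]; _++_; map; concatMap; upTo; length; filter; foldr; zip)
open import Data.Bool.ListAction using (all; any)
open import Data.Product using (_×_; _,_)
open import Data.Integer using (ℤ; +_; -[1+_]; _+_; _*_; _-_)
open import Relation.Nullary.Decidable using (¬?)
open import Relation.Binary.PropositionalEquality using (_≡_)

-- Inversion sequences (as lists σ₁ … σₙ with σᵢ < i, 1-indexed)

invSeqs : ℕ → List (List ℕ)
invSeqs zero    = [] ∷ []
invSeqs (suc n) = concatMap (λ s → map (λ v → s ++ [ v ]) (upTo (suc n))) (invSeqs n)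

subseqs : {A : Set} → List A → List (List A)
subseqs []       = [] ∷ []
subseqs (x ∷ xs) = map (x ∷_) (subseqs xs) ++ subseqs xs

pairs : {A : Set} → List A → List (A × A)
pairs []       = []
pairs (x ∷ xs) = map (x ,_) xs ++ pairs xs

sameOrder : (ℕ × ℕ) × (ℕ × ℕ) → Bool
sameOrder ((a , b) , (c , d)) = eqB (a <ᵇ b) (c <ᵇ d) ∧ eqB (b <ᵇ a) (d <ᵇ c)
  where
  eqB : Bool → Bool → Bool
  eqB true  y = y
  eqB false true  = false
  eqB false false = true

orderIso : List ℕ → List ℕ → Bool
orderIso τ ρ = (length τ ≡ᵇ length ρ) ∧ all sameOrder (zip (pairs τ) (pairs ρ))

containsᵇ : List ℕ → List ℕ → Bool
containsᵇ σ ρ = any (λ τ → orderIso τ ρ) (subseqs σ)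

avoidsAllᵇ : List (List ℕ) → List ℕ → Bool
avoidsAllᵇ P σ = all (λ ρ → if containsᵇ σ ρ then false else true) P

countAvoiders : List (List ℕ) → ℕ → ℕ
countAvoiders P n = length (filter (λ σ → avoidsAllᵇ P σ ≟𝔹 true) (invSeqs n))

Series : Set
Series = ℕ → ℤ

sumℤ : List ℤ → ℤ
sumℤ = foldr _+_ (+ 0)

_⊛_ : Series → Series → Series
(f ⊛ g) n = sumℤ (map (λ k → f k * g (n ∸ k)) (upTo (suc n)))
infixl 7 _⊛_

_⊖_ : Series → Series → Series
(f ⊖ g) n = f n - g n
infixl 6 _⊖_

poly : List ℤ → Series
poly []       n       = + 0
poly (c ∷ cs) zero    = c
poly (c ∷ cs) (suc n) = poly cs n

genFun : List (List ℕ) → Series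
genFun P n = + countAvoiders P n

module Submission where

-- After an earlier value a and a later value b < a no value may exceed a or fall below b. So an avoiding sequence is a weakly
-- increasing prefix with maximum m, followed (if it is not the whole sequence) by a first descent to some y < m,
-- after which all values lie between y and the smallest prefix value z > y. If z < m the rest is weakly
-- increasing; if z = m the values below m are weakly increasing and copies of m are interspersed freely.
-- The continuations of a prefix therefore depend only on its length minus its maximum, on the gap below its
-- maximum and, additively, on the lower gaps. This gives a linear system in one catalytic parameter h, which the
-- kernel method solves: one evaluates at u = x C, where C = 1 + x C² is the Catalan series, so that u = x + u²,
-- √(1 - 4x) = 1 - 2u, and every series involved is rational in u.

open import Defs
open import Level using (0ℓ)
open import Algebra.Bundles using (CommutativeRing; CommutativeMonoid; AbelianGroup)
open import Algebra.Solver.Ring.AlmostCommutativeRing using (fromCommutativeRing; _-Raw-AlmostCommutative⟶_)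
import Algebra.Construct.Pointwise as Pointwise
open import Data.Nat as ℕ using (ℕ; zero; suc; _∸_; z≤n; s≤s; _<ᵇ_; _≤_; _<_)
import Data.Nat.Properties as ℕ
import Data.Nat.Induction as ℕ
open import Data.Integer as ℤ using (ℤ; +_; -[1+_])
import Data.Integer.Properties as ℤ
open import Data.List using (List; []; _∷_; [_]; _++_; applyUpTo; map; concatMap; upTo; length; filter)
open import Data.Fin using (zero; suc)
open import Data.Maybe using (Maybe; just; nothing)
open import Data.Vec using (Vec; []; _∷_)
open import Relation.Nullary using (¬_; yes; no)
open import Relation.Binary.PropositionalEquality as ≡ using (_≡_; _≗_)

-- The kernel computation runs in an arbitrary commutative ring: `x`, `c`, `Y` are known only
-- through `c ≈ 1 + x c²` and `Y ≈ 1 + x Y`, and the evaluation at u only as a linear map `L` with a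
-- shift rule. No division is available, so rational identities are stated with denominators
-- cleared, and `combine` proves each by a certificate: known equations multiplied by cofactors that
-- eliminate the unknowns in turn. The obstacle is that `climb` carries a whole series r and the gap
-- g besides h. Its recursion is affine in r and descents into different gaps contribute additively,
-- so `ψ` splits both off and only the sequence `K`, indexed by h alone, needs the kernel. In the
-- result, 1 - x comes from `Y` and from the sums of `V` and `W`, 1 - 2u from the convolution `Q`,
-- and x³ from writing c as u / x.

module Sum (R : CommutativeRing 0ℓ 0ℓ) where

  open CommutativeRing R hiding (zero)
  open import Relation.Binary.Reasoning.Setoid setoid
  open import Algebra.Properties.CommutativeSemigroup +-commutativeSemigroup using (interchange)

  ∑ : ℕ → (ℕ → Carrier) → Carrier
  ∑ zero    a = 0#
  ∑ (suc n) a = a 0 + ∑ n (λ i → a (suc i))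

  ∑-cong : ∀ n {a b} → (∀ i → i ℕ.< n → a i ≈ b i) → ∑ n a ≈ ∑ n b
  ∑-cong zero    a≈b = refl
  ∑-cong (suc n) a≈b = +-cong (a≈b 0 (ℕ.s≤s ℕ.z≤n)) (∑-cong n (λ i i<n → a≈b (suc i) (ℕ.s≤s i<n)))

  ∑-zero : ∀ n {a} → (∀ i → i ℕ.< n → a i ≈ 0#) → ∑ n a ≈ 0#
  ∑-zero zero    a≈0 = refl
  ∑-zero (suc n) a≈0 =
    trans (+-cong (a≈0 0 (ℕ.s≤s ℕ.z≤n)) (∑-zero n (λ i i<n → a≈0 (suc i) (ℕ.s≤s i<n)))) (+-identityˡ 0#)

  ∑-+ : ∀ n a b → ∑ n (λ i → a i + b i) ≈ ∑ n a + ∑ n b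
  ∑-+ zero    a b = sym (+-identityˡ 0#)
  ∑-+ (suc n) a b = trans (+-congˡ (∑-+ n (λ i → a (suc i)) (λ i → b (suc i)))) (interchange _ _ _ _)

  ∑-*ˡ : ∀ n y a → ∑ n (λ i → y * a i) ≈ y * ∑ n a
  ∑-*ˡ zero    y a = sym (zeroʳ y)
  ∑-*ˡ (suc n) y a = trans (+-congˡ (∑-*ˡ n y (λ i → a (suc i)))) (sym (distribˡ y _ _))

  ∑-last : ∀ n a → ∑ (suc n) a ≈ ∑ n a + a n
  ∑-last zero    a = +-comm (a 0) 0#
  ∑-last (suc n) a = trans (+-congˡ (∑-last n (λ i → a (suc i)))) (sym (+-assoc _ _ _))

  ∑-split : ∀ m n a → ∑ (m ℕ.+ n) a ≈ ∑ m a + ∑ n (λ i → a (m ℕ.+ i))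
  ∑-split zero    n a = sym (+-identityˡ _)
  ∑-split (suc m) n a = trans (+-congˡ (∑-split m n (λ i → a (suc i)))) (sym (+-assoc _ _ _))

-- The kernel method over an arbitrary commutative ring

module Kernel
  (R : CommutativeRing 0ℓ 0ℓ)
  (ι : ℤ.+-*-rawRing -Raw-AlmostCommutative⟶ fromCommutativeRing R)
  where

  open CommutativeRing R hiding (zero)
  open Sum R
  open import Relation.Binary.Reasoning.Setoid setoid
  open import Algebra.Properties.Ring ring using (+-cancelʳ)
  open import Algebra.Properties.Semiring.Exp semiring using (^-congˡ)

  private
    _coeff≟_ : ∀ a b → Maybe (_-Raw-AlmostCommutative⟶_.⟦_⟧ ι a ≈ _-Raw-AlmostCommutative⟶_.⟦_⟧ ι b)
    a coeff≟ b with a ℤ.≟ b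
    ... | yes ≡.refl = just refl
    ... | no  _      = nothing

  open import Algebra.Solver.Ring ℤ.+-*-rawRing (fromCommutativeRing R) ι _coeff≟_

  #[_] : ℤ → Carrier
  #[ a ] = _-Raw-AlmostCommutative⟶_.⟦_⟧ ι a

  -- A ≈ B follows once A - B is recognised as a combination of the differences of known equations.
  combine : ∀ {A B P Q} → A + P ≈ B + Q → P ≈ Q → A ≈ B
  combine {A} {B} {P} {Q} e p≈q = +-cancelʳ P A B (trans e (+-congˡ (sym p≈q)))

  horner : Carrier → List ℤ → Carrier
  horner x []       = #[ + 0 ]
  horner x (a ∷ as) = #[ a ] + x * horner x as

  :horner : ∀ {n} → Polynomial n → List ℤ → Polynomial n
  :horner x []       = con (+ 0)
  :horner x (a ∷ as) = con a :+ x :* :horner x as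

  -- Substitutes for the first variable throughout a polynomial, so that x ≈ u - u² can be applied
  -- everywhere at once without computing a cofactor.
  ⟦⟧-congˡ : ∀ {n y z} {ρ : Vec Carrier n} (p : Polynomial (suc n)) → y ≈ z → ⟦ p ⟧ (y ∷ ρ) ≈ ⟦ p ⟧ (z ∷ ρ)
  ⟦⟧-congˡ (op [+] p q)  y≈z = +-cong (⟦⟧-congˡ p y≈z) (⟦⟧-congˡ q y≈z)
  ⟦⟧-congˡ (op [*] p q)  y≈z = *-cong (⟦⟧-congˡ p y≈z) (⟦⟧-congˡ q y≈z)
  ⟦⟧-congˡ (con a)       y≈z = refl
  ⟦⟧-congˡ (var zero)    y≈z = y≈z
  ⟦⟧-congˡ (var (suc i)) y≈z = refl
  ⟦⟧-congˡ (p :^ k)      y≈z = ^-congˡ k (⟦⟧-congˡ p y≈z)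
  ⟦⟧-congˡ (:- p)        y≈z = -‿cong (⟦⟧-congˡ p y≈z)

  horner-+ : ∀ x c a b a′ b′ → a + b + x * (c * (a′ + b′)) ≈ (a + x * (c * a′)) + (b + x * (c * b′))
  horner-+ = solve 6 (λ x c a b a′ b′ →
    a :+ b :+ x :* (c :* (a′ :+ b′)) := (a :+ x :* (c :* a′)) :+ (b :+ x :* (c :* b′))) refl

  horner-* : ∀ x c y a a′ → y * a + x * (c * (y * a′)) ≈ y * (a + x * (c * a′))
  horner-* = solve 5 (λ x c y a a′ → y :* a :+ x :* (c :* (y :* a′)) := y :* (a :+ x :* (c :* a′))) refl

  -- c is the Catalan series and Y = 1 / (1 - x).
  module Parameters (x c Y : Carrier) (c-eq : c ≈ #[ + 1 ] + x * (c * c)) (Y-eq : Y ≈ #[ + 1 ] + x * Y) where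

    u : Carrier
    u = x * c

    -- (1 - 2u)² ≈ 1 - 4x because u - u² ≈ x. The conclusion stays a product, since the ring need
    -- not be a domain; the second factor is cancelled later, for series.
    difference-of-squares : ∀ S → S * S ≈ horner x (+ 1 ∷ -[1+ 3 ] ∷ []) →
      (S - (#[ + 1 ] - u - u)) * (S + (#[ + 1 ] - u - u)) ≈ #[ + 0 ]
    difference-of-squares S S² = combine
      (solve 3 (λ x c S → let 𝟙 = con (+ 1) ; s = 𝟙 :- x :* c :- x :* c in
          (S :- s) :* (S :+ s) :+ (:horner x (+ 1 ∷ -[1+ 3 ] ∷ []) :+ (con (-[1+ 3 ]) :* x) :* c)
          := con (+ 0) :+ (S :* S :+ (con (-[1+ 3 ]) :* x) :* (𝟙 :+ x :* (c :* c))))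
        refl x c S)
      (+-cong (sym S²) (*-congˡ c-eq))

    G : ℕ → Carrier
    G zero    = c
    G (suc h) = c * G h

    -- `G h` = c^(h+1) counts the weakly increasing continuations alone: repeat the maximum, or
    -- raise it by j + 1 ≤ h. The induction step adds the Catalan equation times `G h` to the
    -- previous case.
    G-eq : ∀ h → G h ≈ #[ + 1 ] + x * (G (suc h) + ∑ h (λ j → G (h ∸ j)))
    G-eq zero    = trans c-eq (+-congˡ (*-congˡ (sym (+-identityʳ (c * c)))))
    G-eq (suc h) = combine
      (solve 4 (λ x c g r →
          c :* g :+ ((con (+ 1) :+ x :* (c :* c)) :* g :+ (con (+ 1) :+ x :* (c :* g :+ r)))
            := (con (+ 1) :+ x :* (c :* (c :* g) :+ (c :* g :+ r))) :+ (c :* g :+ g))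
        refl x c (G h) (∑ h (λ j → G (h ∸ j))))
      (+-cong (*-congʳ (sym c-eq)) (sym (G-eq h)))

    -- v, w, V, W obey the recurrences of gap, topGap, gaps and topGaps below.
    module Gaps
      (v w V W : ℕ → Carrier)
      (v₀ : v 0 ≈ Y) (v₊ : ∀ d → v (suc d) ≈ v d + x * v (suc d))
      (w₀ : w 0 ≈ Y) (w₊ : ∀ d → w (suc d) + x * w d ≈ w d + (x * w (suc d) + x * w (suc d)))
      (V₀ : V 0 ≈ #[ + 0 ]) (V₊ : ∀ g → V (suc g) ≈ v (suc g) + V g)
      (W₀ : W 0 ≈ #[ + 0 ]) (W₊ : ∀ g → W (suc g) ≈ w (suc g) + W g)
      where

      -- t h g accounts for the later descents into a top gap g present when length - maximum = h: they meet
      -- w while the maximum is repeated (factor Y) and v once it has grown (factor G h - Y).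
      t : ℕ → ℕ → Carrier
      t h g = x * (W g * Y + V g * (G h - Y))

      T : ℕ → Carrier
      T h = ∑ h (λ j → t (h ∸ j) (suc j))

      module Solution (K : ℕ → Carrier) (K-eq : ∀ h → K h ≈ #[ + 1 ] + x * (K (suc h) + ∑ h (λ j → K (h ∸ j)) + T h)) where

        -- The solution of the recursion of climb, separated into the contributions of its three parameters.
        ψ : ℕ → ℕ → Carrier → Carrier
        ψ h g r = x * (r * G h) + t h g + K h

        ψ-zero : ∀ h {r} → r ≈ #[ + 0 ] → ψ h 0 r ≈ K h
        ψ-zero h {r} r≈0 = trans
          (+-congʳ (+-cong (*-congˡ (*-congʳ r≈0)) (*-congˡ (+-cong (*-congʳ W₀) (*-congʳ V₀)))))
          (solve 4 (λ x Y g k → x :* (con (+ 0) :* g) :+ x :* (con (+ 0) :* Y :+ con (+ 0) :* (g :- Y)) :+ k := k)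
            refl x Y (G h) (K h))

        ∑-ψ : ∀ h r → ∑ h (λ j → ψ (h ∸ j) (suc j) r)
                ≈ x * (r * ∑ h (λ j → G (h ∸ j))) + T h + ∑ h (λ j → K (h ∸ j))
        ∑-ψ h r = begin
          ∑ h (λ j → ψ (h ∸ j) (suc j) r)
            ≈⟨ ∑-+ h (λ j → x * (r * G (h ∸ j)) + t (h ∸ j) (suc j)) (λ j → K (h ∸ j)) ⟩
          ∑ h (λ j → x * (r * G (h ∸ j)) + t (h ∸ j) (suc j)) + ∑ h (λ j → K (h ∸ j))
            ≈⟨ +-congʳ (∑-+ h (λ j → x * (r * G (h ∸ j))) (λ j → t (h ∸ j) (suc j))) ⟩
          ∑ h (λ j → x * (r * G (h ∸ j))) + T h + ∑ h (λ j → K (h ∸ j))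
            ≈⟨ +-congʳ (+-congʳ (trans (∑-*ˡ h x (λ j → r * G (h ∸ j))) (*-congˡ (∑-*ˡ h r (λ j → G (h ∸ j)))))) ⟩
          x * (r * ∑ h (λ j → G (h ∸ j))) + T h + ∑ h (λ j → K (h ∸ j)) ∎

        -- Each part obeys its own recurrence. The series r follows `G`; the top gap enters r as
        -- `V g` at the first jump, so it follows `G` too, corrected by `Y` for the paths that have
        -- not yet jumped; the gaps opened by new jumps form `T h` and go into `K`. Hence the
        -- cofactors x (r + V g), x W g and x V g.
        ψ-eq : ∀ h g r → ψ h g r ≈
          #[ + 1 ] + x * (r + W g + (ψ (suc h) g r + ∑ h (λ j → ψ (h ∸ j) (suc j) (r + V g))))
        ψ-eq h g r = trans
          (combine
            (solve 12 (λ x Y r Wg Vg G₀ G₁ K₀ K₁ γ κ T →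
                let t₀ = x :* (Wg :* Y :+ Vg :* (G₀ :- Y))
                    t₁ = x :* (Wg :* Y :+ Vg :* (G₁ :- Y))
                    G′ = con (+ 1) :+ x :* (G₁ :+ γ)
                    Y′ = con (+ 1) :+ x :* Y
                    K′ = con (+ 1) :+ x :* (K₁ :+ κ :+ T) in
                (x :* (r :* G₀) :+ t₀ :+ K₀)
                  :+ ((x :* (r :+ Vg)) :* G′ :+ (x :* Wg) :* Y′ :+ (x :* Vg) :* Y :+ K′)
                := (con (+ 1) :+ x :* (r :+ Wg :+ ((x :* (r :* G₁) :+ t₁ :+ K₁)
                     :+ (x :* ((r :+ Vg) :* γ) :+ T :+ κ))))
                  :+ ((x :* (r :+ Vg)) :* G₀ :+ (x :* Wg) :* Y :+ (x :* Vg) :* Y′ :+ K₀))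
              refl x Y r (W g) (V g) (G h) (G (suc h)) (K h) (K (suc h))
                (∑ h (λ j → G (h ∸ j))) (∑ h (λ j → K (h ∸ j))) (T h))
            (+-cong (+-cong (+-cong (*-congˡ (sym (G-eq h))) (*-congˡ (sym Y-eq))) (*-congˡ Y-eq)) (sym (K-eq h))))
          (+-congˡ (*-congˡ (+-congˡ (+-congˡ (sym (∑-ψ h (r + V g)))))))

        -- The only part of `T` in which gap and height are coupled. The others are partial sums,
        -- which collapse to single terms in `T (suc h) - T h`.
        Q : ℕ → Carrier
        Q h = ∑ h (λ j → V (suc j) * G (h ∸ j))

        T-eq : ∀ h → T h ≈ x * (Y * (∑ h (λ j → W (suc j)) - ∑ h (λ j → V (suc j))) + Q h)
        T-eq h = begin
          T h
            ≈⟨ ∑-*ˡ h x (λ j → W (suc j) * Y + V (suc j) * (G (h ∸ j) - Y)) ⟩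
          x * ∑ h (λ j → W (suc j) * Y + V (suc j) * (G (h ∸ j) - Y))
            ≈⟨ *-congˡ (∑-cong h (λ j _ →
                 solve 4 (λ Y w v g → w :* Y :+ v :* (g :- Y) := (Y :* w :+ :- Y :* v) :+ v :* g)
                   refl Y (W (suc j)) (V (suc j)) (G (h ∸ j)))) ⟩
          x * ∑ h (λ j → (Y * W (suc j) + - Y * V (suc j)) + V (suc j) * G (h ∸ j))
            ≈⟨ *-congˡ (trans (∑-+ h (λ j → Y * W (suc j) + - Y * V (suc j)) (λ j → V (suc j) * G (h ∸ j)))
                 (+-congʳ (trans (∑-+ h (λ j → Y * W (suc j)) (λ j → - Y * V (suc j)))
                   (+-cong (∑-*ˡ h Y (λ j → W (suc j))) (∑-*ˡ h (- Y) (λ j → V (suc j))))))) ⟩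
          x * ((Y * ∑ h (λ j → W (suc j)) + - Y * ∑ h (λ j → V (suc j))) + Q h)
            ≈⟨ solve 5 (λ x Y A B Q → x :* ((Y :* A :+ :- Y :* B) :+ Q) := x :* (Y :* (A :- B) :+ Q))
                 refl x Y (∑ h (λ j → W (suc j))) (∑ h (λ j → V (suc j))) (Q h) ⟩
          x * (Y * (∑ h (λ j → W (suc j)) - ∑ h (λ j → V (suc j))) + Q h) ∎

        Q₊ : ∀ h → Q (suc h) ≈ c * Q h + V (suc h) * (c * c)
        Q₊ h = begin
          Q (suc h)
            ≈⟨ ∑-last h (λ j → V (suc j) * G (suc h ∸ j)) ⟩
          ∑ h (λ j → V (suc j) * G (suc h ∸ j)) + V (suc h) * G (suc h ∸ h)
            ≈⟨ +-cong (∑-cong h (λ j j<h → trans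
                   (*-congˡ (reflexive (≡.cong G (ℕ.+-∸-assoc 1 (ℕ.<⇒≤ j<h)))))
                   (solve 3 (λ v c g → v :* (c :* g) := c :* (v :* g)) refl (V (suc j)) c (G (h ∸ j)))))
                 (*-congˡ (reflexive (≡.cong G (ℕ.m+n∸n≡m 1 h)))) ⟩
          ∑ h (λ j → c * (V (suc j) * G (h ∸ j))) + V (suc h) * (c * c)
            ≈⟨ +-congʳ (∑-*ˡ h c (λ j → V (suc j) * G (h ∸ j))) ⟩
          c * Q h + V (suc h) * (c * c) ∎

        T₊ : ∀ h → T (suc h) - T h ≈ x * (Y * (W (suc h) - V (suc h)) + (Q (suc h) - Q h))
        T₊ h = trans
          (+-cong (trans (T-eq (suc h)) (*-congˡ (+-congʳ (*-congˡ (+-cong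
              (∑-last h (λ j → W (suc j))) (-‿cong (∑-last h (λ j → V (suc j)))))))))
            (-‿cong (T-eq h)))
          (solve 8 (λ x Y A B w v Q₀ Q₁ →
              x :* (Y :* ((A :+ w) :- (B :+ v)) :+ Q₁) :- x :* (Y :* (A :- B) :+ Q₀)
                := x :* (Y :* (w :- v) :+ (Q₁ :- Q₀)))
            refl x Y (∑ h (λ j → W (suc j))) (∑ h (λ j → V (suc j))) (W (suc h)) (V (suc h)) (Q h) (Q (suc h)))

        -- Differencing replaces the sum over all smaller heights by a three-term recurrence, to
        -- which `L` with its shift rule applies.
        K₊ : ∀ h → K (suc h) ≈ K h + x * (K (suc (suc h)) + (T (suc h) - T h))
        K₊ h = combine
          (solve 7 (λ x K₀ K₁ K₂ κ T₀ T₁ →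
              K₁ :+ (con (+ 1) :+ x :* (K₂ :+ (K₁ :+ κ) :+ T₁) :+ K₀)
              := (K₀ :+ x :* (K₂ :+ (T₁ :- T₀))) :+ (K₁ :+ (con (+ 1) :+ x :* (K₁ :+ κ :+ T₀))))
            refl x (K h) (K (suc h)) (K (suc (suc h))) (∑ h (λ j → K (h ∸ j))) (T h) (T (suc h)))
          (+-cong (sym (K-eq (suc h))) (K-eq h))

        -- L a stands for ∑ₕ uʰ aₕ.
        module Evaluation
          (L : (ℕ → Carrier) → Carrier)
          (L-cong : ∀ {a b} → (∀ h → a h ≈ b h) → L a ≈ L b)
          (L-+ : ∀ a b → L (λ h → a h + b h) ≈ L a + L b)
          (L-* : ∀ y a → L (λ h → y * a h) ≈ y * L a)
          (L-shift : ∀ a → L a ≈ a 0 + u * L (λ h → a (suc h)))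
          where

          L-neg : ∀ a → L (λ h → - a h) ≈ - L a
          L-neg a = begin
            L (λ h → - a h)           ≈⟨ L-cong (λ h → solve 1 (λ a → :- a := con (-[1+ 0 ]) :* a) refl (a h)) ⟩
            L (λ h → #[ -[1+ 0 ] ] * a h)  ≈⟨ L-* #[ -[1+ 0 ] ] a ⟩
            #[ -[1+ 0 ] ] * L a            ≈⟨ solve 1 (λ a → con (-[1+ 0 ]) :* a := :- a) refl (L a) ⟩
            - L a                     ∎

          L-sub : ∀ a b → L (λ h → a h - b h) ≈ L a - L b
          L-sub a b = trans (L-+ a (λ h → - b h)) (+-congˡ (L-neg b))

          L-shift₀ : ∀ a → a 0 ≈ #[ + 0 ] → L a ≈ #[ + 0 ] + u * L (λ h → a (suc h))
          L-shift₀ a a₀ = trans (L-shift a) (+-congʳ a₀)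

          -- The solver's zero is the image of the integer 0, which for series agrees with `0#` only
          -- pointwise.
          0#≈#[0] : 0# ≈ #[ + 0 ]
          0#≈#[0] = sym (_-Raw-AlmostCommutative⟶_.0-homo ι)

          -- Here v d = Y^(d+1), a geometric sum with value 1 / (1 - x - u). With x = u - u² the
          -- denominator is (1 - u)², and c = 1 / (1 - u).
          L-v : L v ≈ c * c
          L-v = combine
            (solve 5 (λ x c Y l l′ →
                let 𝟙 = con (+ 1) ; u = x :* c in
                l :+ (c :* c :* (𝟙 :- x) :* (Y :+ u :* l′) :+ c :* c :* (𝟙 :+ x :* Y) :+ c :* c :* u :* (l :+ x :* l′)
                       :+ l :* (𝟙 :+ c) :* c)
                := c :* c :+ (c :* c :* (𝟙 :- x) :* l :+ c :* c :* Y :+ c :* c :* u :* l′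
                       :+ l :* (𝟙 :+ c) :* (𝟙 :+ x :* (c :* c))))
              refl x c Y (L v) (L (λ h → v (suc h))))
            (+-cong (+-cong (+-cong
              (*-congˡ (sym (trans (L-shift v) (+-congʳ v₀))))
              (*-congˡ (sym Y-eq)))
              (*-congˡ (sym (trans (L-cong v₊) (trans (L-+ v (λ h → x * v (suc h))) (+-congˡ (L-* x _)))))))
              (*-congˡ c-eq))

          -- Here w d = Y ((1 - x) / (1 - 2x))^d. The denominator 1 - 2x - u + u x of the geometric
          -- sum is (1 - u)³ at x = u - u².
          L-w : L w ≈ c * c * c * ((#[ + 1 ] - x - x) * Y)
          L-w = combine
            (solve 5 (λ x c Y l l′ →
                let 𝟙 = con (+ 1) ; u = x :* c ; c³ = c :* c :* c
                    q = c :* c :+ c :+ 𝟙 :- x :* c :* c in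
                l :+ (c³ :* (𝟙 :- x :- x) :* (Y :+ u :* l′) :+ c³ :* u :* (l :+ (x :* l′ :+ x :* l′))
                       :+ l :* q :* c)
                := c³ :* ((𝟙 :- x :- x) :* Y) :+ (c³ :* (𝟙 :- x :- x) :* l :+ c³ :* u :* (l′ :+ x :* l)
                       :+ l :* q :* (𝟙 :+ x :* (c :* c))))
              refl x c Y (L w) (L (λ h → w (suc h))))
            (+-cong (+-cong
              (*-congˡ (sym (trans (L-shift w) (+-congʳ w₀))))
              (*-congˡ (begin
                L w + (x * L′ + x * L′)
                  ≈⟨ +-congˡ (+-cong (L-* x _) (L-* x _)) ⟨
                L w + (L (λ h → x * w (suc h)) + L (λ h → x * w (suc h)))
                  ≈⟨ +-congˡ (L-+ _ _) ⟨
                L w + L (λ h → x * w (suc h) + x * w (suc h))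
                  ≈⟨ L-+ _ _ ⟨
                L (λ h → w h + (x * w (suc h) + x * w (suc h)))
                  ≈⟨ L-cong w₊ ⟨
                L (λ h → w (suc h) + x * w h)
                  ≈⟨ L-+ _ _ ⟩
                L′ + L (λ h → x * w h)
                  ≈⟨ +-congˡ (L-* x w) ⟩
                L′ + x * L w ∎)))
              (*-congˡ c-eq))
            where L′ = L (λ h → w (suc h))

          -- Partial sums cost a factor 1 / (1 - u) = c; they start at index 1, whence the
          -- subtraction of `a 0`.
          L-partial : ∀ {a b} → b 0 ≈ #[ + 0 ] → (∀ g → b (suc g) ≈ a (suc g) + b g) →
            L b ≈ c * (L a - a 0)
          L-partial {a} {b} b₀ b₊ = combine
            (solve 7 (λ x c a₀ l l′ m m′ → let u = x :* c in
                m :+ (c :* (con (+ 0) :+ u :* m′) :+ c :* u :* (l′ :+ m) :+ c :* l :+ m :* c)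
                := c :* (l :- a₀) :+ (c :* m :+ c :* u :* m′ :+ c :* (a₀ :+ u :* l′) :+ m :* (con (+ 1) :+ x :* (c :* c))))
              refl x c (a 0) (L a) (L (λ h → a (suc h))) (L b) (L (λ h → b (suc h))))
            (+-cong (+-cong (+-cong
              (*-congˡ (sym (L-shift₀ b b₀)))
              (*-congˡ (sym (trans (L-cong b₊) (L-+ _ b)))))
              (*-congˡ (L-shift a)))
              (*-congˡ c-eq))

          L-V : (#[ + 1 ] - x) * L V ≈ c * (c * c * (#[ + 1 ] - x) - #[ + 1 ])
          L-V = combine
            (solve 4 (λ x c Y l → let 𝟙 = con (+ 1) ; b = c :* (c :* c :* (𝟙 :- x) :- 𝟙) in
                (𝟙 :- x) :* l :+ ((𝟙 :- x) :* (c :* (c :* c :- Y)) :+ (:- c) :* (𝟙 :+ x :* Y))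
                := b :+ ((𝟙 :- x) :* l :+ (:- c) :* Y))
              refl x c Y (L V))
            (+-cong
              (*-congˡ (sym (trans (L-partial V₀ V₊) (*-congˡ (+-cong L-v (-‿cong v₀))))))
              (*-congˡ (sym Y-eq)))

          L-W : (#[ + 1 ] - x) * L W ≈ c * (c * c * c * (#[ + 1 ] - x - x) - #[ + 1 ])
          L-W = combine
            (solve 4 (λ x c Y l → let 𝟙 = con (+ 1) ; b = c :* (c :* c :* c :* (𝟙 :- x :- x) :- 𝟙) in
                (𝟙 :- x) :* l :+ ((𝟙 :- x) :* (c :* (c :* c :* c :* ((𝟙 :- x :- x) :* Y) :- Y)) :+ b :* (𝟙 :+ x :* Y))
                := b :+ ((𝟙 :- x) :* l :+ b :* Y))
              refl x c Y (L W))
            (+-cong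
              (*-congˡ (sym (trans (L-partial W₀ W₊) (*-congˡ (+-cong L-w (-‿cong w₀))))))
              (*-congˡ (sym Y-eq)))

          -- The powers of c in `G` make a geometric sum with denominator 1 - u c = (1 - 2u) c. This
          -- is where √(1 - 4x) enters a denominator.
          L-Q : (#[ + 1 ] - u - u) * L Q ≈ c * L V
          L-Q = combine
            (solve 6 (λ x c q q′ l l′ → let 𝟙 = con (+ 1) ; u = x :* c in
                (𝟙 :- u :- u) :* q
                  :+ ((u :* q :+ c :* l) :* (𝟙 :+ x :* (c :* c)) :+ (𝟙 :- u) :* (con (+ 0) :+ u :* q′)
                    :+ (𝟙 :- u) :* u :* (c :* q :+ c :* c :* l′) :+ (𝟙 :- u) :* c :* c :* l)
                := c :* l
                  :+ ((u :* q :+ c :* l) :* c :+ (𝟙 :- u) :* q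
                    :+ (𝟙 :- u) :* u :* q′ :+ (𝟙 :- u) :* c :* c :* (con (+ 0) :+ u :* l′)))
              refl x c (L Q) (L (λ h → Q (suc h))) (L V) (L (λ h → V (suc h))))
            (+-cong (+-cong (+-cong
              (*-congˡ (sym c-eq))
              (*-congˡ (sym (L-shift₀ Q 0#≈#[0]))))
              (*-congˡ (sym (begin
                L (λ h → Q (suc h))
                  ≈⟨ L-cong (λ h → trans (Q₊ h) (+-congˡ (*-comm _ _))) ⟩
                L (λ h → c * Q h + c * c * V (suc h))
                  ≈⟨ L-+ _ _ ⟩
                L (λ h → c * Q h) + L (λ h → c * c * V (suc h))
                  ≈⟨ +-cong (L-* c Q) (L-* (c * c) _) ⟩
                c * L Q + c * c * L (λ h → V (suc h)) ∎))))
              (*-congˡ (L-shift₀ V V₀)))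

          u*L-T : u * L (λ h → T (suc h) - T h) ≈ x * (Y * (L W - L V) + (L Q - u * L Q))
          u*L-T = begin
            u * L (λ h → T (suc h) - T h)
              ≈⟨ *-congˡ (trans (L-cong T₊) (trans (L-* x _) (*-congˡ (trans (L-+ _ _)
                   (+-cong (trans (L-* Y _) (*-congˡ (L-sub _ _))) (L-sub _ _)))))) ⟩
            u * (x * (Y * (W′ - V′) + (Q′ - L Q)))
              ≈⟨ solve 7 (λ u x Y w v q′ q →
                   u :* (x :* (Y :* (w :- v) :+ (q′ :- q)))
                   := x :* (Y :* ((con (+ 0) :+ u :* w) :- (con (+ 0) :+ u :* v)) :+ ((con (+ 0) :+ u :* q′) :- u :* q)))
                 refl u x Y W′ V′ Q′ (L Q) ⟩
            x * (Y * ((#[ + 0 ] + u * W′) - (#[ + 0 ] + u * V′)) + ((#[ + 0 ] + u * Q′) - u * L Q))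
              ≈⟨ *-congˡ (+-cong (*-congˡ (+-cong (L-shift₀ W W₀) (-‿cong (L-shift₀ V V₀))))
                   (+-congʳ (L-shift₀ Q 0#≈#[0]))) ⟨
            x * (Y * (L W - L V) + (L Q - u * L Q)) ∎
            where
            W′ = L (λ h → W (suc h))
            V′ = L (λ h → V (suc h))
            Q′ = L (λ h → Q (suc h))

          -- The kernel method: since u = x + u², the unknown L K cancels.
          K₀-eq : K 0 ≈ c + u * (x * (Y * (L W - L V) + (L Q - u * L Q)))
          K₀-eq = trans
            (combine
              (solve 8 (λ x c K₀ K₁ k k′ k″ τ → let 𝟙 = con (+ 1) ; u = x :* c in
                  K₀ :+ (c :* u :* (k :+ x :* (k″ :+ τ)) :+ k :* c :+ c :* (K₀ :+ u :* k′) :+ k :+ u :* k′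
                           :+ c :* (𝟙 :+ x :* K₁))
                  := (c :+ u :* (u :* τ))
                     :+ (c :* u :* k′ :+ k :* (𝟙 :+ x :* (c :* c)) :+ c :* k :+ (K₀ :+ u :* k′) :+ u :* (K₁ :+ u :* k″)
                           :+ c :* K₀))
                refl x c (K 0) (K 1) (L K) (L (λ h → K (suc h))) (L (λ h → K (suc (suc h))))
                  (L (λ h → T (suc h) - T h)))
              (+-cong (+-cong (+-cong (+-cong (+-cong
                (*-congˡ (sym (trans (L-cong K₊) (trans (L-+ _ _) (+-congˡ (trans (L-* x _) (*-congˡ (L-+ _ _))))))))
                (*-congˡ c-eq))
                (*-congˡ (sym (L-shift K))))
                (L-shift K))
                (*-congˡ (L-shift (λ h → K (suc h)))))
                -- At h = 0 both sums in `K-eq` are empty, so it expresses `K 1` through `K 0`.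
                (*-congˡ (sym (trans (K-eq 0) (+-congˡ (*-congˡ (trans (+-identityʳ _) (+-identityʳ _)))))))))
            (+-congˡ (*-congˡ u*L-T))

          x-eq : x ≈ u - u * u
          x-eq = combine
            (solve 2 (λ x c → let u = x :* c in
                x :+ x :* c := (u :- u :* u) :+ x :* (con (+ 1) :+ x :* (c :* c)))
              refl x c)
            (*-congˡ c-eq)

          -- A single factor s = 1 - 2u would clear the denominator; s² is used because it equals 1
          -- - 4x, so that the factor of `K 0` becomes a polynomial in x.
          K₀-rational :
            let s = #[ + 1 ] - u - u ; y = #[ + 1 ] - x in
            y * y * (s * s) * K 0 ≈
              c * (y * y * (s * s)) + u * x * c * (s * s * (c * c * c * (y - x) - c * c * y) + s * y * (c * c * y - #[ + 1 ]))
          K₀-rational = combine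
            (solve 7 (λ x c Y K₀ w v q →
                let 𝟙 = con (+ 1) ; u = x :* c ; s = 𝟙 :- u :- u ; y = 𝟙 :- x
                    a = c :* (c :* c :* c :* (𝟙 :- x :- x) :- 𝟙)
                    b = c :* (c :* c :* (𝟙 :- x) :- 𝟙)
                    -- Cofactors in order of elimination: α inserts `K₀-eq`, β removes `Y`, γ uses
                    -- `L-W` and `L-V`, δ uses `L-Q`, ε uses `L-V` for the term that δ leaves, and ζ
                    -- reduces c (1 - u) to 1.
                    α = y :* y :* (s :* s)
                    β = u :* x :* s :* s :* y :* (w :- v)
                    γ = u :* x :* s :* s
                    δ = u :* x :* y :* y :* s :* (𝟙 :- u)
                    ε = u :* x :* y :* s :* c :* (𝟙 :- u)
                    ζ = u :* x :* y :* s :* b in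
                α :* K₀
                  :+ (α :* (c :+ u :* (x :* (Y :* (w :- v) :+ (q :- u :* q)))) :+ β :* (𝟙 :+ x :* Y) :+ γ :* a
                      :+ γ :* (y :* v) :+ δ :* (c :* v) :+ ε :* b :+ ζ :* (𝟙 :+ x :* (c :* c)))
                := (c :* (y :* y :* (s :* s))
                      :+ u :* x :* c :* (s :* s :* (c :* c :* c :* (y :- x) :- c :* c :* y) :+ s :* y :* (c :* c :* y :- 𝟙)))
                  :+ (α :* K₀ :+ β :* Y :+ γ :* (y :* w) :+ γ :* b :+ δ :* (s :* q) :+ ε :* (y :* v) :+ ζ :* c))
              refl x c Y (K 0) (L W) (L V) (L Q))
            (+-cong (+-cong (+-cong (+-cong (+-cong (+-cong
              (*-congˡ (sym K₀-eq))
              (*-congˡ (sym Y-eq)))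
              (*-congˡ (sym L-W)))
              (*-congˡ L-V))
              (*-congˡ (sym L-Q)))
              (*-congˡ (sym L-V)))
              (*-congˡ (sym c-eq)))

          closed-form : ∀ S → S ≈ #[ + 1 ] - u - u →
            horner x (+ 0 ∷ + 0 ∷ + 0 ∷ + 2 ∷ []) * horner x (-[1+ 0 ] ∷ + 4 ∷ []) * horner x (-[1+ 0 ] ∷ + 1 ∷ [])
              * horner x (-[1+ 0 ] ∷ + 1 ∷ []) * K 0
            ≈ horner x (-[1+ 0 ] ∷ + 4 ∷ []) * horner x (+ 1 ∷ -[1+ 8 ] ∷ + 25 ∷ -[1+ 21 ] ∷ + 4 ∷ [])
              - horner x (-[1+ 0 ] ∷ + 2 ∷ []) * horner x (+ 1 ∷ -[1+ 4 ] ∷ + 1 ∷ [])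
                * horner x (+ 1 ∷ -[1+ 3 ] ∷ + 2 ∷ []) * S
          closed-form S S-eq = begin
            _ ≈⟨ combine
                  (solve 3 (λ x c K₀ →
                      let 𝟙 = con (+ 1) ; u = x :* c ; s = 𝟙 :- u :- u ; y = 𝟙 :- x ; m = con (-[1+ 1 ]) :* (x :* x :* x)
                          -- η trades s² for 1 - 4x: the two differ by 4x (1 - c + x c²), which
                          -- vanishes.
                          η = con (-[1+ 3 ]) :* x :* m :* (y :* y :* K₀) in
                      :D x :* K₀ :+ (m :* :Z x c :+ η :* c)
                        := :P x u :+ (m :* (y :* y :* (s :* s) :* K₀) :+ η :* (𝟙 :+ x :* (c :* c))))
                    refl x c (K 0))
                  (+-cong (*-congˡ (sym K₀-rational)) (*-congˡ c-eq)) ⟩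
            -- After replacing x by u - u², `:P` and `:N` are polynomials in u alone and coincide
            -- identically; the substitution is then undone in `:N`.
            ⟦ :P (var zero) (var (suc zero)) ⟧ (x ∷ u ∷ [])
              ≈⟨ ⟦⟧-congˡ {ρ = u ∷ []} (:P (var zero) (var (suc zero))) x-eq ⟩
            ⟦ :P (var zero) (var (suc zero)) ⟧ ((u - u * u) ∷ u ∷ [])
              ≈⟨ solve 1 (λ u → :P (u :- u :* u) u := :N (u :- u :* u) (con (+ 1) :- u :- u)) refl u ⟩
            ⟦ :N (var zero) (con (+ 1) :- var (suc zero) :- var (suc zero)) ⟧ ((u - u * u) ∷ u ∷ [])
              ≈⟨ ⟦⟧-congˡ {ρ = u ∷ []} (:N (var zero) (con (+ 1) :- var (suc zero) :- var (suc zero))) x-eq ⟨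
            ⟦ :N (var zero) (con (+ 1) :- var (suc zero) :- var (suc zero)) ⟧ (x ∷ u ∷ [])
              ≈⟨ +-congˡ (-‿cong (*-congˡ S-eq)) ⟨
            _ ∎
            where
            :D : ∀ {n} → Polynomial n → Polynomial n
            :D x = :horner x (+ 0 ∷ + 0 ∷ + 0 ∷ + 2 ∷ []) :* :horner x (-[1+ 0 ] ∷ + 4 ∷ [])
              :* :horner x (-[1+ 0 ] ∷ + 1 ∷ []) :* :horner x (-[1+ 0 ] ∷ + 1 ∷ [])

            :N : ∀ {n} → Polynomial n → Polynomial n → Polynomial n
            :N x s = :horner x (-[1+ 0 ] ∷ + 4 ∷ []) :* :horner x (+ 1 ∷ -[1+ 8 ] ∷ + 25 ∷ -[1+ 21 ] ∷ + 4 ∷ [])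
              :- :horner x (-[1+ 0 ] ∷ + 2 ∷ []) :* :horner x (+ 1 ∷ -[1+ 4 ] ∷ + 1 ∷ [])
                :* :horner x (+ 1 ∷ -[1+ 3 ] ∷ + 2 ∷ []) :* s

            :Z : ∀ {n} → Polynomial n → Polynomial n → Polynomial n
            :Z x c =
              let 𝟙 = con (+ 1) ; u = x :* c ; s = 𝟙 :- u :- u ; y = 𝟙 :- x in
              c :* (y :* y :* (s :* s))
                :+ u :* x :* c :* (s :* s :* (c :* c :* c :* (y :- x) :- c :* c :* y) :+ s :* y :* (c :* c :* y :- 𝟙))

            -- - 2 x³ Z rewritten without c by means of x c = u.
            :P : ∀ {n} → Polynomial n → Polynomial n → Polynomial n
            :P x u =
              let 𝟙 = con (+ 1) ; s = 𝟙 :- u :- u ; y = 𝟙 :- x in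
              con (-[1+ 1 ]) :* (x :* x :* u :* (y :* y :* (s :* s))
                :+ u :* (s :* s :* (u :* u :* u :* u :* (y :- x) :- x :* (u :* u :* u) :* y)
                  :+ s :* y :* (x :* (u :* u :* u) :* y :- x :* x :* x :* u)))

-- The ring of formal power series over ℤ

open import Data.Bool using (Bool; true; false; _∧_; _∨_; not; if_then_else_)
import Data.Bool.Properties as Bool
open import Data.Bool.ListAction using (any)
open import Data.Empty using (⊥-elim)
open import Data.Integer.Solver using (module +-*-Solver)
open import Data.List.Properties using (map-applyUpTo; map-++; map-∘; map-cong)
open import Data.List.Membership.Propositional using (_∈_)
open import Data.List.Membership.Propositional.Properties using (∈-++⁺ˡ; ∈-++⁺ʳ; ∈-++⁻; ∈-map⁺; ∈-map⁻)
open import Data.List.Relation.Unary.Any using (here; there)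
open import Data.Product using (_×_; _,_; proj₁; proj₂; ∃)
open import Data.Sum using (_⊎_; inj₁; inj₂)
open import Function using (_∘_; id)
open import Relation.Binary.Definitions using (tri<; tri≈; tri>)
open import Relation.Nullary.Decidable using (dec-true; dec-false)
open ≡ using (refl; cong; cong₂; sym; trans; subst)
open ≡.≡-Reasoning

tail : Series → Series
tail f n = f (suc n)

⊛-zero : ∀ f g → (f ⊛ g) 0 ≡ f 0 ℤ.* g 0
⊛-zero f g = ℤ.+-identityʳ _

-- The product rule for `tail`: tail (f g) = f 0 · tail g + tail f · g. All ring laws below follow
-- from it by induction on the coefficient index.
⊛-suc : ∀ f g n → (f ⊛ g) (suc n) ≡ f 0 ℤ.* g (suc n) ℤ.+ (tail f ⊛ g) n
⊛-suc f g n = cong (λ ks → f 0 ℤ.* g (suc n) ℤ.+ sumℤ ks)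
  (trans (map-applyUpTo suc (λ k → f k ℤ.* g (suc n ∸ k)) (suc n))
    (sym (map-applyUpTo id (λ k → f (suc k) ℤ.* g (n ∸ k)) (suc n))))

⊛-cong-≤ : ∀ n {f f′ g g′} → (∀ k → k ℕ.≤ n → f k ≡ f′ k) → (∀ k → k ℕ.≤ n → g k ≡ g′ k) →
  (f ⊛ g) n ≡ (f′ ⊛ g′) n
⊛-cong-≤ zero {f} {f′} {g} {g′} f≡ g≡ = begin
  (f ⊛ g) 0       ≡⟨ ⊛-zero f g ⟩
  f 0 ℤ.* g 0     ≡⟨ cong₂ ℤ._*_ (f≡ 0 z≤n) (g≡ 0 z≤n) ⟩
  f′ 0 ℤ.* g′ 0   ≡⟨ ⊛-zero f′ g′ ⟨
  (f′ ⊛ g′) 0     ∎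
⊛-cong-≤ (suc n) {f} {f′} {g} {g′} f≡ g≡ = begin
  (f ⊛ g) (suc n)
    ≡⟨ ⊛-suc f g n ⟩
  f 0 ℤ.* g (suc n) ℤ.+ (tail f ⊛ g) n
    ≡⟨ cong₂ ℤ._+_ (cong₂ ℤ._*_ (f≡ 0 z≤n) (g≡ (suc n) ℕ.≤-refl))
         (⊛-cong-≤ n (λ k k≤n → f≡ (suc k) (s≤s k≤n)) (λ k k≤n → g≡ k (ℕ.m≤n⇒m≤1+n k≤n))) ⟩
  f′ 0 ℤ.* g′ (suc n) ℤ.+ (tail f′ ⊛ g′) n
    ≡⟨ ⊛-suc f′ g′ n ⟨
  (f′ ⊛ g′) (suc n) ∎

⊛-cong : ∀ {f f′ g g′} → f ≗ f′ → g ≗ g′ → (f ⊛ g) ≗ (f′ ⊛ g′)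
⊛-cong f≗ g≗ n = ⊛-cong-≤ n (λ k _ → f≗ k) (λ k _ → g≗ k)

⊛-sucʳ : ∀ f g n → (f ⊛ g) (suc n) ≡ f (suc n) ℤ.* g 0 ℤ.+ (f ⊛ tail g) n
⊛-sucʳ f g zero = begin
  (f ⊛ g) 1                            ≡⟨ ⊛-suc f g 0 ⟩
  f 0 ℤ.* g 1 ℤ.+ (tail f ⊛ g) 0       ≡⟨ ℤ.+-comm (f 0 ℤ.* g 1) _ ⟩
  (tail f ⊛ g) 0 ℤ.+ f 0 ℤ.* g 1       ≡⟨ cong₂ ℤ._+_ (⊛-zero (tail f) g) (sym (⊛-zero f (tail g))) ⟩
  f 1 ℤ.* g 0 ℤ.+ (f ⊛ tail g) 0       ∎
⊛-sucʳ f g (suc n) = begin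
  (f ⊛ g) (suc (suc n))
    ≡⟨ ⊛-suc f g (suc n) ⟩
  f 0 ℤ.* g (suc (suc n)) ℤ.+ (tail f ⊛ g) (suc n)
    ≡⟨ cong (ℤ._+_ (f 0 ℤ.* g (suc (suc n)))) (⊛-sucʳ (tail f) g n) ⟩
  f 0 ℤ.* g (suc (suc n)) ℤ.+ (f (suc (suc n)) ℤ.* g 0 ℤ.+ (tail f ⊛ tail g) n)
    ≡⟨ solve 3 (λ a b c → a :+ (b :+ c) := b :+ (a :+ c)) refl
         (f 0 ℤ.* g (suc (suc n))) (f (suc (suc n)) ℤ.* g 0) ((tail f ⊛ tail g) n) ⟩
  f (suc (suc n)) ℤ.* g 0 ℤ.+ (f 0 ℤ.* g (suc (suc n)) ℤ.+ (tail f ⊛ tail g) n)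
    ≡⟨ cong (ℤ._+_ (f (suc (suc n)) ℤ.* g 0)) (⊛-suc f (tail g) n) ⟨
  f (suc (suc n)) ℤ.* g 0 ℤ.+ (f ⊛ tail g) (suc n) ∎
  where open +-*-Solver

⊛-comm : ∀ f g → (f ⊛ g) ≗ (g ⊛ f)
⊛-comm f g zero = begin
  (f ⊛ g) 0     ≡⟨ ⊛-zero f g ⟩
  f 0 ℤ.* g 0   ≡⟨ ℤ.*-comm (f 0) (g 0) ⟩
  g 0 ℤ.* f 0   ≡⟨ ⊛-zero g f ⟨
  (g ⊛ f) 0     ∎
⊛-comm f g (suc n) = begin
  (f ⊛ g) (suc n)                        ≡⟨ ⊛-suc f g n ⟩
  f 0 ℤ.* g (suc n) ℤ.+ (tail f ⊛ g) n   ≡⟨ cong₂ ℤ._+_ (ℤ.*-comm (f 0) (g (suc n))) (⊛-comm (tail f) g n) ⟩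
  g (suc n) ℤ.* f 0 ℤ.+ (g ⊛ tail f) n   ≡⟨ ⊛-sucʳ g f n ⟨
  (g ⊛ f) (suc n)                        ∎

infixl 6 _⊕_
_⊕_ : Series → Series → Series
(f ⊕ g) n = f n ℤ.+ g n

⊛-distribʳ : ∀ h f g → ((f ⊕ g) ⊛ h) ≗ (f ⊛ h ⊕ g ⊛ h)
⊛-distribʳ h f g zero = begin
  ((f ⊕ g) ⊛ h) 0               ≡⟨ ⊛-zero (f ⊕ g) h ⟩
  (f 0 ℤ.+ g 0) ℤ.* h 0         ≡⟨ ℤ.*-distribʳ-+ (h 0) (f 0) (g 0) ⟩
  f 0 ℤ.* h 0 ℤ.+ g 0 ℤ.* h 0   ≡⟨ cong₂ ℤ._+_ (⊛-zero f h) (⊛-zero g h) ⟨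
  (f ⊛ h ⊕ g ⊛ h) 0             ∎
⊛-distribʳ h f g (suc n) = begin
  ((f ⊕ g) ⊛ h) (suc n)
    ≡⟨ ⊛-suc (f ⊕ g) h n ⟩
  (f 0 ℤ.+ g 0) ℤ.* h (suc n) ℤ.+ ((tail f ⊕ tail g) ⊛ h) n
    ≡⟨ cong (ℤ._+_ ((f 0 ℤ.+ g 0) ℤ.* h (suc n))) (⊛-distribʳ h (tail f) (tail g) n) ⟩
  (f 0 ℤ.+ g 0) ℤ.* h (suc n) ℤ.+ ((tail f ⊛ h) n ℤ.+ (tail g ⊛ h) n)
    ≡⟨ solve 5 (λ a b c d e → (a :+ b) :* c :+ (d :+ e) := (a :* c :+ d) :+ (b :* c :+ e)) refl
         (f 0) (g 0) (h (suc n)) ((tail f ⊛ h) n) ((tail g ⊛ h) n) ⟩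
  (f 0 ℤ.* h (suc n) ℤ.+ (tail f ⊛ h) n) ℤ.+ (g 0 ℤ.* h (suc n) ℤ.+ (tail g ⊛ h) n)
    ≡⟨ cong₂ ℤ._+_ (⊛-suc f h n) (⊛-suc g h n) ⟨
  (f ⊛ h ⊕ g ⊛ h) (suc n) ∎
  where open +-*-Solver

⊛-distribˡ : ∀ h f g → (h ⊛ (f ⊕ g)) ≗ (h ⊛ f ⊕ h ⊛ g)
⊛-distribˡ h f g n = begin
  (h ⊛ (f ⊕ g)) n     ≡⟨ ⊛-comm h (f ⊕ g) n ⟩
  ((f ⊕ g) ⊛ h) n     ≡⟨ ⊛-distribʳ h f g n ⟩
  (f ⊛ h ⊕ g ⊛ h) n   ≡⟨ cong₂ ℤ._+_ (⊛-comm f h n) (⊛-comm g h n) ⟩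
  (h ⊛ f ⊕ h ⊛ g) n   ∎

⊛-scaleˡ : ∀ a f g → ((λ k → a ℤ.* f k) ⊛ g) ≗ (λ n → a ℤ.* (f ⊛ g) n)
⊛-scaleˡ a f g zero = begin
  ((λ k → a ℤ.* f k) ⊛ g) 0   ≡⟨ ⊛-zero (λ k → a ℤ.* f k) g ⟩
  a ℤ.* f 0 ℤ.* g 0           ≡⟨ ℤ.*-assoc a (f 0) (g 0) ⟩
  a ℤ.* (f 0 ℤ.* g 0)         ≡⟨ cong (a ℤ.*_) (⊛-zero f g) ⟨
  a ℤ.* (f ⊛ g) 0             ∎
⊛-scaleˡ a f g (suc n) = begin
  ((λ k → a ℤ.* f k) ⊛ g) (suc n)
    ≡⟨ ⊛-suc (λ k → a ℤ.* f k) g n ⟩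
  a ℤ.* f 0 ℤ.* g (suc n) ℤ.+ ((λ k → a ℤ.* tail f k) ⊛ g) n
    ≡⟨ cong (ℤ._+_ (a ℤ.* f 0 ℤ.* g (suc n))) (⊛-scaleˡ a (tail f) g n) ⟩
  a ℤ.* f 0 ℤ.* g (suc n) ℤ.+ a ℤ.* (tail f ⊛ g) n
    ≡⟨ solve 4 (λ a b c d → a :* b :* c :+ a :* d := a :* (b :* c :+ d)) refl a (f 0) (g (suc n)) ((tail f ⊛ g) n) ⟩
  a ℤ.* (f 0 ℤ.* g (suc n) ℤ.+ (tail f ⊛ g) n)
    ≡⟨ cong (a ℤ.*_) (⊛-suc f g n) ⟨
  a ℤ.* (f ⊛ g) (suc n) ∎
  where open +-*-Solver

⊛-assoc : ∀ f g h → ((f ⊛ g) ⊛ h) ≗ (f ⊛ (g ⊛ h))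
⊛-assoc f g h zero = begin
  ((f ⊛ g) ⊛ h) 0             ≡⟨ ⊛-zero (f ⊛ g) h ⟩
  (f ⊛ g) 0 ℤ.* h 0           ≡⟨ cong (ℤ._* h 0) (⊛-zero f g) ⟩
  f 0 ℤ.* g 0 ℤ.* h 0         ≡⟨ ℤ.*-assoc (f 0) (g 0) (h 0) ⟩
  f 0 ℤ.* (g 0 ℤ.* h 0)       ≡⟨ cong (f 0 ℤ.*_) (⊛-zero g h) ⟨
  f 0 ℤ.* (g ⊛ h) 0           ≡⟨ ⊛-zero f (g ⊛ h) ⟨
  (f ⊛ (g ⊛ h)) 0             ∎
⊛-assoc f g h (suc n) = begin
  ((f ⊛ g) ⊛ h) (suc n)
    ≡⟨ ⊛-suc (f ⊛ g) h n ⟩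
  (f ⊛ g) 0 ℤ.* h (suc n) ℤ.+ (tail (f ⊛ g) ⊛ h) n
    ≡⟨ cong₂ (λ a b → a ℤ.* h (suc n) ℤ.+ b) (⊛-zero f g) (⊛-cong {g = h} (⊛-suc f g) (λ _ → refl) n) ⟩
  f 0 ℤ.* g 0 ℤ.* h (suc n) ℤ.+ (((λ k → f 0 ℤ.* tail g k) ⊕ tail f ⊛ g) ⊛ h) n
    ≡⟨ cong (ℤ._+_ (f 0 ℤ.* g 0 ℤ.* h (suc n))) (trans (⊛-distribʳ h (λ k → f 0 ℤ.* tail g k) (tail f ⊛ g) n)
         (cong₂ ℤ._+_ (⊛-scaleˡ (f 0) (tail g) h n) (⊛-assoc (tail f) g h n))) ⟩
  f 0 ℤ.* g 0 ℤ.* h (suc n) ℤ.+ (f 0 ℤ.* (tail g ⊛ h) n ℤ.+ (tail f ⊛ (g ⊛ h)) n)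
    ≡⟨ solve 5 (λ a b c d e → a :* b :* c :+ (a :* d :+ e) := a :* (b :* c :+ d) :+ e) refl
         (f 0) (g 0) (h (suc n)) ((tail g ⊛ h) n) ((tail f ⊛ (g ⊛ h)) n) ⟩
  f 0 ℤ.* (g 0 ℤ.* h (suc n) ℤ.+ (tail g ⊛ h) n) ℤ.+ (tail f ⊛ (g ⊛ h)) n
    ≡⟨ cong (λ a → f 0 ℤ.* a ℤ.+ (tail f ⊛ (g ⊛ h)) n) (⊛-suc g h n) ⟨
  f 0 ℤ.* (g ⊛ h) (suc n) ℤ.+ (tail f ⊛ (g ⊛ h)) n
    ≡⟨ ⊛-suc f (g ⊛ h) n ⟨
  (f ⊛ (g ⊛ h)) (suc n) ∎
  where open +-*-Solver

⊛-zeroˡ : ∀ f → (poly [] ⊛ f) ≗ poly []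
⊛-zeroˡ f zero    = ⊛-zero (poly []) f
⊛-zeroˡ f (suc n) = trans (⊛-suc (poly []) f n) (trans (ℤ.+-identityˡ _) (⊛-zeroˡ f n))

const : ℤ → Series
const a = poly (a ∷ [])

const-⊛ : ∀ a f → (const a ⊛ f) ≗ (λ n → a ℤ.* f n)
const-⊛ a f zero    = ⊛-zero (const a) f
const-⊛ a f (suc n) = trans (⊛-suc (const a) f n) (trans (cong (ℤ._+_ (a ℤ.* f (suc n))) (⊛-zeroˡ f n)) (ℤ.+-identityʳ _))

⊛-identityˡ : ∀ f → (const (+ 1) ⊛ f) ≗ f
⊛-identityˡ f n = trans (const-⊛ (+ 1) f n) (ℤ.*-identityˡ (f n))

seriesRing : CommutativeRing 0ℓ 0ℓ
seriesRing = record
  { Carrier = Series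
  ; _≈_     = _≗_
  ; _+_     = _⊕_
  ; _*_     = _⊛_
  ; -_      = λ f n → ℤ.- f n
  ; 0#      = λ _ → + 0
  ; 1#      = const (+ 1)
  ; isCommutativeRing = record
    { isRing = record
      { +-isAbelianGroup = AbelianGroup.isAbelianGroup (Pointwise.abelianGroup ℕ ℤ.+-0-abelianGroup)
      ; *-cong     = ⊛-cong
      ; *-assoc    = ⊛-assoc
      ; *-identity = ⊛-identityˡ , λ f n → trans (⊛-comm f (const (+ 1)) n) (⊛-identityˡ f n)
      ; distrib    = ⊛-distribˡ , ⊛-distribʳ
      }
    ; *-comm = ⊛-comm
    }
  }

constants : ℤ.+-*-rawRing -Raw-AlmostCommutative⟶ fromCommutativeRing seriesRing
constants = record
  { ⟦_⟧    = const
  ; +-homo = λ where a b zero → refl ; a b (suc n) → refl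
  ; *-homo = λ where
      a b zero    → sym (const-⊛ a (const b) 0)
      a b (suc n) → sym (trans (const-⊛ a (const b) (suc n)) (ℤ.*-zeroʳ a))
  ; -‿homo = λ where a zero → refl ; a (suc n) → refl
  ; 0-homo = λ where zero → refl ; (suc n) → refl
  ; 1-homo = λ _ → refl
  }

-- Transfer of the kernel computation to power series

module 𝕊 = CommutativeRing seriesRing
open Kernel seriesRing constants
module ∑ℤ = Sum ℤ.+-*-commutativeRing
module ∑𝕊 = Sum seriesRing

x : Series
x = poly (+ 0 ∷ + 1 ∷ [])

x⊛-suc : ∀ f n → (x ⊛ f) (suc n) ≡ f n
x⊛-suc f n = begin
  (x ⊛ f) (suc n)             ≡⟨ ⊛-suc x f n ⟩
  + 0 ℤ.+ (tail x ⊛ f) n      ≡⟨ ℤ.+-identityˡ _ ⟩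
  (tail x ⊛ f) n              ≡⟨ ⊛-cong {tail x} {const (+ 1)} {f} (λ _ → refl) (λ _ → refl) n ⟩
  (const (+ 1) ⊛ f) n         ≡⟨ ⊛-identityˡ f n ⟩
  f n                         ∎

≗-unfold : ∀ {f g a} → f 0 ≡ a → (∀ n → f (suc n) ≡ g n) → f ≗ (const a ⊕ x ⊛ g)
≗-unfold {f} {g} {a} f₀ f₊ zero    = trans f₀ (sym (ℤ.+-identityʳ a))
≗-unfold {f} {g} {a} f₀ f₊ (suc n) = trans (f₊ n) (trans (sym (x⊛-suc g n)) (sym (ℤ.+-identityˡ _)))

poly-horner : ∀ as → poly as ≗ horner x as
poly-horner []       zero    = refl
poly-horner []       (suc n) = refl
poly-horner (a ∷ as) n       = trans
  (≗-unfold {poly (a ∷ as)} {poly as} refl (λ _ → refl) n)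
  (cong (ℤ._+_ (const a n)) (⊛-cong {x} {x} (λ _ → refl) (poly-horner as) n))

∑𝕊-at : ∀ m a n → ∑𝕊.∑ m a n ≡ ∑ℤ.∑ m (λ i → a i n)
∑𝕊-at zero    a n = refl
∑𝕊-at (suc m) a n = cong (ℤ._+_ (a 0 n)) (∑𝕊-at m (λ i → a (suc i)) n)

-- ballot n h = [xⁿ] Cʰ⁺¹.
ballot : ℕ → ℕ → ℤ
ballot zero    h       = + 1
ballot (suc n) zero    = ballot n 1
ballot (suc n) (suc h) = ballot (suc n) h ℤ.+ ballot n (suc (suc h))

catalan : Series
catalan n = ballot n 0

-- The recursion of `ballot` is C^(h+2) = C^(h+1) + x C^(h+3). It is structural, unlike a definition
-- of `catalan` through its own convolution; the quadratic equation is recovered from h = 0.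
ballot-⊛-catalan : ∀ n h → ((λ k → ballot k h) ⊛ catalan) n ≡ ballot n (suc h)
ballot-⊛-catalan zero    h = refl
ballot-⊛-catalan (suc n) zero = begin
  (catalan ⊛ catalan) (suc n)
    ≡⟨ ⊛-suc catalan catalan n ⟩
  + 1 ℤ.* catalan (suc n) ℤ.+ ((λ k → ballot k 1) ⊛ catalan) n
    ≡⟨ cong₂ ℤ._+_ (ℤ.*-identityˡ (catalan (suc n))) (ballot-⊛-catalan n 1) ⟩
  ballot (suc n) 1 ∎
ballot-⊛-catalan (suc n) (suc h) = begin
  ((λ k → ballot k (suc h)) ⊛ catalan) (suc n)
    ≡⟨ ⊛-suc (λ k → ballot k (suc h)) catalan n ⟩
  + 1 ℤ.* catalan (suc n) ℤ.+ ((tail (λ k → ballot k h) ⊕ (λ k → ballot k (suc (suc h)))) ⊛ catalan) n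
    ≡⟨ cong (ℤ._+_ (+ 1 ℤ.* catalan (suc n)))
         (⊛-distribʳ catalan (tail (λ k → ballot k h)) (λ k → ballot k (suc (suc h))) n) ⟩
  + 1 ℤ.* catalan (suc n) ℤ.+ ((tail (λ k → ballot k h) ⊛ catalan) n ℤ.+ ((λ k → ballot k (suc (suc h))) ⊛ catalan) n)
    ≡⟨ ℤ.+-assoc (+ 1 ℤ.* catalan (suc n)) _ _ ⟨
  + 1 ℤ.* catalan (suc n) ℤ.+ (tail (λ k → ballot k h) ⊛ catalan) n ℤ.+ ((λ k → ballot k (suc (suc h))) ⊛ catalan) n
    ≡⟨ cong₂ ℤ._+_ (sym (⊛-suc (λ k → ballot k h) catalan n)) (ballot-⊛-catalan n (suc (suc h))) ⟩
  ((λ k → ballot k h) ⊛ catalan) (suc n) ℤ.+ ballot n (suc (suc (suc h)))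
    ≡⟨ cong (λ a → a ℤ.+ ballot n (suc (suc (suc h)))) (ballot-⊛-catalan (suc n) h) ⟩
  ballot (suc n) (suc (suc h)) ∎

catalan-eq : catalan ≗ (const (+ 1) ⊕ x ⊛ (catalan ⊛ catalan))
catalan-eq = ≗-unfold {catalan} {catalan ⊛ catalan} refl (λ n → sym (ballot-⊛-catalan n 0))

⊛-leading : ∀ n f g → (∀ {k} → k ℕ.< n → f k ≡ + 0) → (f ⊛ g) n ≡ f n ℤ.* g 0
⊛-leading zero    f g f≡0 = ⊛-zero f g
⊛-leading (suc n) f g f≡0 = begin
  (f ⊛ g) (suc n)                        ≡⟨ ⊛-suc f g n ⟩
  f 0 ℤ.* g (suc n) ℤ.+ (tail f ⊛ g) n   ≡⟨ cong (λ a → a ℤ.* g (suc n) ℤ.+ (tail f ⊛ g) n) (f≡0 (s≤s z≤n)) ⟩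
  + 0 ℤ.+ (tail f ⊛ g) n                 ≡⟨ ℤ.+-identityˡ _ ⟩
  (tail f ⊛ g) n                         ≡⟨ ⊛-leading n (tail f) g (λ k<n → f≡0 (s≤s k<n)) ⟩
  f (suc n) ℤ.* g 0                      ∎

-- If f vanishes below n, the coefficient of xⁿ in f g is just f n · g 0.
⊛-cancel : ∀ f g → g 0 ≡ + 2 → (f ⊛ g) ≗ (λ _ → + 0) → f ≗ (λ _ → + 0)
⊛-cancel f g g₀ fg≡0 = ℕ.<-rec _ λ n f≡0 → ℤ.*-cancelʳ-≡ (f n) (+ 0) (+ 2)
  (begin
    f n ℤ.* + 2   ≡⟨ cong (f n ℤ.*_) g₀ ⟨
    f n ℤ.* g 0   ≡⟨ ⊛-leading n f g f≡0 ⟨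
    (f ⊛ g) n     ≡⟨ fg≡0 n ⟩
    + 0           ∎)

-- Numbers of continuations by l values when the window of admissible values has width d: its upper end is below the
-- maximum for gap, so that only weakly increasing continuations are left, and is the maximum for topGap.
gap : ℕ → Series
gap d zero    = + 1
gap d (suc l) = ∑ℤ.∑ (suc d) (λ j → gap (d ∸ j) l)

topGap : ℕ → Series
topGap d zero    = + 1
topGap d (suc l) = topGap d l ℤ.+ ∑ℤ.∑ d (λ j → topGap (d ∸ j) l)

gaps : ℕ → Series
gaps g l = ∑ℤ.∑ g (λ j → gap (g ∸ j) l)

topGaps : ℕ → Series
topGaps g l = ∑ℤ.∑ g (λ j → topGap (g ∸ j) l)

-- The number of continuations by l values of a weakly increasing prefix of length maximum + h whose two largest
-- distinct values differ by g and whose lower gaps contribute the series r.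
climb : ℕ → ℕ → ℕ → Series → ℤ
climb zero    h g r = + 1
climb (suc l) h g r = r l ℤ.+ topGaps g l ℤ.+
  (climb l (suc h) g r ℤ.+ ∑ℤ.∑ h (λ j → climb l (h ∸ j) (suc j) (r ⊕ gaps g)))

-- A window of width 0 has one continuation of each length, so `gap 0` is 1 / (1 - x).
open Parameters x catalan (gap 0) catalan-eq (≗-unfold {gap 0} {gap 0} refl (λ n → ℤ.+-identityʳ _))

module _ (S : Series) (S₀ : S 0 ≡ + 1) (S² : S ⊛ S ≗ poly (+ 1 ∷ -[1+ 3 ] ∷ [])) where

  private
    s : Series
    s = (const (+ 1) ⊖ u) ⊖ u

  -- Both series square to 1 - 4x, and their sum has constant term 2, so it can be cancelled.
  sqrt-unique : S ≗ ((const (+ 1) ⊖ u) ⊖ u)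
  sqrt-unique n = ℤ.i-j≡0⇒i≡j (S n) (s n) (⊛-cancel (S ⊖ s) (S ⊕ s) S+s₀ S-s*S+s n)
    where
    S+s₀ : (S ⊕ s) 0 ≡ + 2
    S+s₀ = cong (ℤ._+ + 1) S₀

    S-s*S+s : ((S ⊖ s) ⊛ (S ⊕ s)) ≗ (λ _ → + 0)
    S-s*S+s = 𝕊.trans
      (difference-of-squares S (𝕊.trans S² (poly-horner (+ 1 ∷ -[1+ 3 ] ∷ []))))
      (_-Raw-AlmostCommutative⟶_.0-homo constants)

-- Evaluation of a sequence of series at u

horner-sum : ℕ → (ℕ → Series) → Series
horner-sum zero    a = λ _ → + 0
horner-sum (suc m) a = a 0 ⊕ x ⊛ (catalan ⊛ horner-sum m (λ h → a (suc h)))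

-- ∑ₕ uʰ aₕ, which converges because x divides u.
evaluate : (ℕ → Series) → Series
evaluate a n = horner-sum (suc n) a n

-- Each Horner level carries a factor x, so the terms from index n + 1 on do not reach the
-- coefficient of xⁿ.
horner-sum-stable : ∀ l m n a → n ℕ.< l → n ℕ.< m → horner-sum l a n ≡ horner-sum m a n
horner-sum-stable (suc l) (suc m) zero    a _         _         = refl
horner-sum-stable (suc l) (suc m) (suc n) a (s≤s n<l) (s≤s n<m) = cong (ℤ._+_ (a 0 (suc n))) (begin
  (x ⊛ (catalan ⊛ horner-sum l a′)) (suc n)   ≡⟨ x⊛-suc (catalan ⊛ horner-sum l a′) n ⟩
  (catalan ⊛ horner-sum l a′) n               ≡⟨ ⊛-cong-≤ n {catalan} (λ _ _ → refl) (λ k k≤n →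
                                                   horner-sum-stable l m k a′ (ℕ.≤-<-trans k≤n n<l) (ℕ.≤-<-trans k≤n n<m)) ⟩
  (catalan ⊛ horner-sum m a′) n               ≡⟨ x⊛-suc (catalan ⊛ horner-sum m a′) n ⟨
  (x ⊛ (catalan ⊛ horner-sum m a′)) (suc n)   ∎)
  where a′ = λ h → a (suc h)

evaluate-cong : ∀ {a b} → (∀ h → a h ≗ b h) → evaluate a ≗ evaluate b
evaluate-cong a≗b n = go (suc n) a≗b n
  where
  go : ∀ m {a b} → (∀ h → a h ≗ b h) → horner-sum m a ≗ horner-sum m b
  go zero    a≗b = 𝕊.refl
  go (suc m) a≗b = 𝕊.+-cong (a≗b 0) (𝕊.*-congˡ {x} (𝕊.*-congˡ {catalan} (go m (λ h → a≗b (suc h)))))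

evaluate-⊕ : ∀ a b → evaluate (λ h → a h ⊕ b h) ≗ (evaluate a ⊕ evaluate b)
evaluate-⊕ a b n = go (suc n) a b n
  where
  go : ∀ m a b → horner-sum m (λ h → a h ⊕ b h) ≗ (horner-sum m a ⊕ horner-sum m b)
  go zero    a b = 𝕊.refl
  go (suc m) a b = 𝕊.trans
    (𝕊.+-congˡ {a 0 ⊕ b 0} (𝕊.*-congˡ {x} (𝕊.*-congˡ {catalan} (go m (λ h → a (suc h)) (λ h → b (suc h))))))
    (horner-+ x catalan (a 0) (b 0) (horner-sum m (λ h → a (suc h))) (horner-sum m (λ h → b (suc h))))

evaluate-⊛ : ∀ y a → evaluate (λ h → y ⊛ a h) ≗ (y ⊛ evaluate a)
evaluate-⊛ y a n = begin
  horner-sum (suc n) (λ h → y ⊛ a h) n   ≡⟨ go (suc n) a n ⟩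
  (y ⊛ horner-sum (suc n) a) n           ≡⟨ ⊛-cong-≤ n {y} (λ _ _ → refl) (λ k k≤n →
                                              horner-sum-stable (suc n) (suc k) k a (s≤s k≤n) ℕ.≤-refl) ⟩
  (y ⊛ evaluate a) n                     ∎
  where
  go : ∀ m a → horner-sum m (λ h → y ⊛ a h) ≗ (y ⊛ horner-sum m a)
  go zero    a = 𝕊.sym (𝕊.zeroʳ y)
  go (suc m) a = 𝕊.trans
    (𝕊.+-congˡ {y ⊛ a 0} (𝕊.*-congˡ {x} (𝕊.*-congˡ {catalan} (go m (λ h → a (suc h))))))
    (horner-* x catalan y (a 0) (horner-sum m (λ h → a (suc h))))

evaluate-shift : ∀ a → evaluate a ≗ (a 0 ⊕ u ⊛ evaluate (λ h → a (suc h)))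
evaluate-shift a n = cong (ℤ._+_ (a 0 n)) (trans (go n) (sym (⊛-assoc x catalan (evaluate a′) n)))
  where
  a′ = λ h → a (suc h)
  -- The factor x lowers the coefficient index by one, so one Horner level fewer suffices.
  go : ∀ n → (x ⊛ (catalan ⊛ horner-sum n a′)) n ≡ (x ⊛ (catalan ⊛ evaluate a′)) n
  go zero    = refl
  go (suc n) = begin
    (x ⊛ (catalan ⊛ horner-sum (suc n) a′)) (suc n)
      ≡⟨ x⊛-suc (catalan ⊛ horner-sum (suc n) a′) n ⟩
    (catalan ⊛ horner-sum (suc n) a′) n
      ≡⟨ ⊛-cong-≤ n {catalan} (λ _ _ → refl) (λ k k≤n →
           horner-sum-stable (suc n) (suc k) k a′ (s≤s k≤n) ℕ.≤-refl) ⟩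
    (catalan ⊛ evaluate a′) n
      ≡⟨ x⊛-suc (catalan ⊛ evaluate a′) n ⟨
    (x ⊛ (catalan ⊛ evaluate a′)) (suc n) ∎

-- Solution of the counting recursions

gap-suc : ∀ d → gap (suc d) ≗ (gap d ⊕ x ⊛ gap (suc d))
gap-suc d zero    = refl
gap-suc d (suc n) = trans (ℤ.+-comm (gap (suc d) n) (gap d (suc n))) (cong (ℤ._+_ (gap d (suc n))) (sym (x⊛-suc (gap (suc d)) n)))

topGap-zero : topGap 0 ≗ gap 0
topGap-zero zero    = refl
topGap-zero (suc n) = cong (ℤ._+ + 0) (topGap-zero n)

-- This is (1 - 2x) w (d+1) = (1 - x) w d without subtraction: the sum over narrower windows is
-- common to two consecutive widths.
topGap-suc : ∀ d → (topGap (suc d) ⊕ x ⊛ topGap d) ≗ (topGap d ⊕ (x ⊛ topGap (suc d) ⊕ x ⊛ topGap (suc d)))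
topGap-suc d zero    = refl
topGap-suc d (suc n) = begin
  a ℤ.+ (a ℤ.+ s) ℤ.+ (x ⊛ topGap d) (suc n)      ≡⟨ cong (ℤ._+_ (a ℤ.+ (a ℤ.+ s))) (x⊛-suc (topGap d) n) ⟩
  a ℤ.+ (a ℤ.+ s) ℤ.+ b                           ≡⟨ solve 3 (λ a b s → a :+ (a :+ s) :+ b := b :+ s :+ (a :+ a)) refl a b s ⟩
  b ℤ.+ s ℤ.+ (a ℤ.+ a)                           ≡⟨ cong (λ c → b ℤ.+ s ℤ.+ (c ℤ.+ c)) (x⊛-suc (topGap (suc d)) n) ⟨
  topGap d (suc n) ℤ.+ ((x ⊛ topGap (suc d)) (suc n) ℤ.+ (x ⊛ topGap (suc d)) (suc n)) ∎
  where
  open +-*-Solver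
  a = topGap (suc d) n
  b = topGap d n
  s = topGaps d n

zero-series : (λ _ → + 0) ≗ const (+ 0)
zero-series zero    = refl
zero-series (suc n) = refl

open Gaps gap topGap gaps topGaps 𝕊.refl gap-suc topGap-zero topGap-suc
  zero-series (λ _ _ → refl) zero-series (λ _ _ → refl)

-- The value of `climb` at g = 0 and r = 0: a prefix with no gap below its maximum to descend into.
plain : ℕ → Series
plain h zero    = + 1
plain h (suc l) = plain (suc h) l ℤ.+ ∑ℤ.∑ h (λ j → plain (h ∸ j) l) ℤ.+ T h l

plain-eq : ∀ h → plain h ≗ (const (+ 1) ⊕ x ⊛ ((plain (suc h) ⊕ ∑𝕊.∑ h (λ j → plain (h ∸ j))) ⊕ T h))
plain-eq h = ≗-unfold {plain h} refl
  (λ n → cong (λ a → plain (suc h) n ℤ.+ a ℤ.+ T h n) (sym (∑𝕊-at h (λ j → plain (h ∸ j)) n)))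

open Solution plain plain-eq

climb≡ψ : ∀ l h g r → climb l h g r ≡ ψ h g r l
climb≡ψ zero    h g r = sym (ψ-eq h g r 0)
climb≡ψ (suc l) h g r = begin
  climb (suc l) h g r
    ≡⟨ cong₂ (λ a b → r l ℤ.+ topGaps g l ℤ.+ (a ℤ.+ b)) (climb≡ψ l (suc h) g r)
         (trans (∑ℤ.∑-cong h (λ j _ → climb≡ψ l (h ∸ j) (suc j) (r ⊕ gaps g)))
           (sym (∑𝕊-at h (λ j → ψ (h ∸ j) (suc j) (r ⊕ gaps g)) l))) ⟩
  φ l
    ≡⟨ x⊛-suc φ l ⟨
  (x ⊛ φ) (suc l)
    ≡⟨ ℤ.+-identityˡ _ ⟨
  (const (+ 1) ⊕ x ⊛ φ) (suc l)
    ≡⟨ ψ-eq h g r (suc l) ⟨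
  ψ h g r (suc l) ∎
  where
  φ : Series
  φ = (r ⊕ topGaps g) ⊕ (ψ (suc h) g r ⊕ ∑𝕊.∑ h (λ j → ψ (h ∸ j) (suc j) (r ⊕ gaps g)))

open Evaluation evaluate evaluate-cong evaluate-⊕ evaluate-⊛ evaluate-shift

-- The sequence [0] has h = 1. From h = 0 the recursion can only move to h = 1, so the empty
-- sequence fits in as h = 0, and `F` is the very series `K 0` that the kernel method yields.
count-by-climb : (F : Series) → F 0 ≡ + 1 → (∀ l → F (suc l) ≡ climb l 1 0 (λ _ → + 0)) → F ≗ plain 0
count-by-climb F F₀ F₊ zero    = F₀
count-by-climb F F₀ F₊ (suc l) = begin
  F (suc l)                        ≡⟨ F₊ l ⟩
  climb l 1 0 (λ _ → + 0)          ≡⟨ climb≡ψ l 1 0 (λ _ → + 0) ⟩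
  ψ 1 0 (λ _ → + 0) l              ≡⟨ ψ-zero 1 zero-series l ⟩
  plain 1 l                        ≡⟨ trans (ℤ.+-identityʳ _) (ℤ.+-identityʳ _) ⟨
  plain 0 (suc l)                  ∎

climb-closed-form : (F : Series) → F 0 ≡ + 1 → (∀ l → F (suc l) ≡ climb l 1 0 (λ _ → + 0)) →
  (S : Series) → S 0 ≡ + 1 → (∀ n → (S ⊛ S) n ≡ poly (+ 1 ∷ -[1+ 3 ] ∷ []) n) →
    ∀ n →
      (poly (+ 0 ∷ + 0 ∷ + 0 ∷ + 2 ∷ []) ⊛ poly (-[1+ 0 ] ∷ + 4 ∷ []) ⊛ poly (-[1+ 0 ] ∷ + 1 ∷ []) ⊛ poly (-[1+ 0 ] ∷ + 1 ∷ [])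
        ⊛ F) n
      ≡
      (poly (-[1+ 0 ] ∷ + 4 ∷ []) ⊛ poly (+ 1 ∷ -[1+ 8 ] ∷ + 25 ∷ -[1+ 21 ] ∷ + 4 ∷ [])
        ⊖ poly (-[1+ 0 ] ∷ + 2 ∷ []) ⊛ poly (+ 1 ∷ -[1+ 4 ] ∷ + 1 ∷ []) ⊛ poly (+ 1 ∷ -[1+ 3 ] ∷ + 2 ∷ []) ⊛ S) n
climb-closed-form F F₀ F₊ S S₀ S² = 𝕊.trans
  (⊛-cong
    (⊛-cong (⊛-cong (⊛-cong
      (poly-horner (+ 0 ∷ + 0 ∷ + 0 ∷ + 2 ∷ []))
      (poly-horner (-[1+ 0 ] ∷ + 4 ∷ [])))
      (poly-horner (-[1+ 0 ] ∷ + 1 ∷ [])))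
      (poly-horner (-[1+ 0 ] ∷ + 1 ∷ [])))
    (count-by-climb F F₀ F₊))
  (𝕊.trans (closed-form S (sqrt-unique S S₀ S²))
    (𝕊.sym (𝕊.+-cong
      (⊛-cong (poly-horner (-[1+ 0 ] ∷ + 4 ∷ [])) (poly-horner (+ 1 ∷ -[1+ 8 ] ∷ + 25 ∷ -[1+ 21 ] ∷ + 4 ∷ [])))
      (𝕊.-‿cong (⊛-cong {g = S}
        (⊛-cong (⊛-cong
          (poly-horner (-[1+ 0 ] ∷ + 2 ∷ []))
          (poly-horner (+ 1 ∷ -[1+ 4 ] ∷ + 1 ∷ [])))
          (poly-horner (+ 1 ∷ -[1+ 3 ] ∷ + 2 ∷ [])))
        (λ _ → refl))))))

-- Counting avoiding sequences by appending values

any-++ : ∀ {A : Set} (p : A → Bool) xs ys → any p (xs ++ ys) ≡ any p xs ∨ any p ys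
any-++ p []       ys = refl
any-++ p (x ∷ xs) ys = trans (cong (p x ∨_) (any-++ p xs ys)) (sym (Bool.∨-assoc (p x) _ _))

any-map : ∀ {A B : Set} (p : B → Bool) (f : A → B) xs → any p (map f xs) ≡ any (p ∘ f) xs
any-map p f []       = refl
any-map p f (x ∷ xs) = cong (p (f x) ∨_) (any-map p f xs)

any-subseqs-∷ : ∀ {A : Set} (p : List A → Bool) x xs →
  any p (subseqs (x ∷ xs)) ≡ any (p ∘ (x ∷_)) (subseqs xs) ∨ any p (subseqs xs)
any-subseqs-∷ p x xs = trans (any-++ p (map (x ∷_) (subseqs xs)) (subseqs xs))
  (cong (_∨ any p (subseqs xs)) (any-map p (x ∷_) (subseqs xs)))

any-subseqs-snoc : ∀ {A : Set} (p : List A → Bool) xs v →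
  any p (subseqs (xs ++ [ v ])) ≡ any p (subseqs xs) ∨ any (λ τ → p (τ ++ [ v ])) (subseqs xs)
any-subseqs-snoc p [] v = begin
  p [ v ] ∨ (p [] ∨ false)             ≡⟨ Bool.∨-comm (p [ v ]) _ ⟩
  (p [] ∨ false) ∨ p [ v ]             ≡⟨ cong ((p [] ∨ false) ∨_) (Bool.∨-identityʳ (p [ v ])) ⟨
  (p [] ∨ false) ∨ (p [ v ] ∨ false)   ∎
any-subseqs-snoc p (x ∷ xs) v = begin
  any p (subseqs (x ∷ xs ++ [ v ]))
    ≡⟨ any-subseqs-∷ p x (xs ++ [ v ]) ⟩
  any (p ∘ (x ∷_)) (subseqs (xs ++ [ v ])) ∨ any p (subseqs (xs ++ [ v ]))
    ≡⟨ cong₂ _∨_ (any-subseqs-snoc (p ∘ (x ∷_)) xs v) (any-subseqs-snoc p xs v) ⟩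
  (a ∨ b) ∨ (c ∨ d)
    ≡⟨ interchange a b c d ⟩
  (a ∨ c) ∨ (b ∨ d)
    ≡⟨ cong₂ _∨_ (any-subseqs-∷ p x xs) (any-subseqs-∷ (λ τ → p (τ ++ [ v ])) x xs) ⟨
  any p (subseqs (x ∷ xs)) ∨ any (λ τ → p (τ ++ [ v ])) (subseqs (x ∷ xs)) ∎
  where
  open import Algebra.Properties.CommutativeSemigroup (CommutativeMonoid.commutativeSemigroup Bool.∨-commutativeMonoid)
    using (interchange)
  a = any (p ∘ (x ∷_)) (subseqs xs)
  b = any (λ τ → p (x ∷ τ ++ [ v ])) (subseqs xs)
  c = any p (subseqs xs)
  d = any (λ τ → p (τ ++ [ v ])) (subseqs xs)

any-const-false : ∀ {A : Set} (p : A → Bool) xs → (∀ x → p x ≡ false) → any p xs ≡ false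
any-const-false p []       p≡f = refl
any-const-false p (x ∷ xs) p≡f rewrite p≡f x = any-const-false p xs p≡f

any-subseqs-[] : ∀ {A : Set} (p : List A → Bool) xs → (∀ a τ → p (a ∷ τ) ≡ false) →
  any p (subseqs xs) ≡ p []
any-subseqs-[] p []       p∷ = Bool.∨-identityʳ (p [])
any-subseqs-[] p (x ∷ xs) p∷ = begin
  any p (subseqs (x ∷ xs))                               ≡⟨ any-subseqs-∷ p x xs ⟩
  any (p ∘ (x ∷_)) (subseqs xs) ∨ any p (subseqs xs)     ≡⟨ cong₂ _∨_ (any-const-false _ (subseqs xs) (p∷ x)) (any-subseqs-[] p xs p∷) ⟩
  p []                                                   ∎

any-subseqs-singleton : ∀ {A : Set} (p : List A → Bool) xs → p [] ≡ false → (∀ a b τ → p (a ∷ b ∷ τ) ≡ false) →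
  any p (subseqs xs) ≡ any (λ a → p [ a ]) xs
any-subseqs-singleton p []       p[] p∷∷ = cong (_∨ false) p[]
any-subseqs-singleton p (x ∷ xs) p[] p∷∷ = trans (any-subseqs-∷ p x xs)
  (cong₂ _∨_ (any-subseqs-[] (p ∘ (x ∷_)) xs (p∷∷ x)) (any-subseqs-singleton p xs p[] p∷∷))

any-subseqs-pair : ∀ {A : Set} (p : List A → Bool) xs → p [] ≡ false → (∀ a → p [ a ] ≡ false) →
  (∀ a b c τ → p (a ∷ b ∷ c ∷ τ) ≡ false) →
  any p (subseqs xs) ≡ any (λ (a , b) → p (a ∷ b ∷ [])) (pairs xs)
any-subseqs-pair p []       p[] p∷ p∷∷∷ = cong (_∨ false) p[]
any-subseqs-pair p (x ∷ xs) p[] p∷ p∷∷∷ = begin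
  any p (subseqs (x ∷ xs))
    ≡⟨ any-subseqs-∷ p x xs ⟩
  any (p ∘ (x ∷_)) (subseqs xs) ∨ any p (subseqs xs)
    ≡⟨ cong₂ _∨_ (any-subseqs-singleton (p ∘ (x ∷_)) xs (p∷ x) (p∷∷∷ x)) (any-subseqs-pair p xs p[] p∷ p∷∷∷) ⟩
  any (λ b → p (x ∷ b ∷ [])) xs ∨ any (λ (a , b) → p (a ∷ b ∷ [])) (pairs xs)
    ≡⟨ cong (_∨ any (λ (a , b) → p (a ∷ b ∷ [])) (pairs xs)) (any-map (λ (a , b) → p (a ∷ b ∷ [])) (x ,_) xs) ⟨
  any (λ (a , b) → p (a ∷ b ∷ [])) (map (x ,_) xs) ∨ any (λ (a , b) → p (a ∷ b ∷ [])) (pairs xs)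
    ≡⟨ any-++ (λ (a , b) → p (a ∷ b ∷ [])) (map (x ,_) xs) (pairs xs) ⟨
  any (λ (a , b) → p (a ∷ b ∷ [])) (pairs (x ∷ xs)) ∎

-- A new occurrence must end in v, and its other two entries form a pair of s. Thus avoidance can be
-- tested value by value.
containsᵇ-snoc : ∀ {r₁ r₂ r₃} s v → containsᵇ (s ++ [ v ]) (r₁ ∷ r₂ ∷ r₃ ∷ [])
  ≡ containsᵇ s (r₁ ∷ r₂ ∷ r₃ ∷ []) ∨ any (λ (a , b) → orderIso (a ∷ b ∷ v ∷ []) (r₁ ∷ r₂ ∷ r₃ ∷ [])) (pairs s)
containsᵇ-snoc {r₁} {r₂} {r₃} s v = trans
  (any-subseqs-snoc (λ τ → orderIso τ (r₁ ∷ r₂ ∷ r₃ ∷ [])) s v)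
  (cong (containsᵇ s (r₁ ∷ r₂ ∷ r₃ ∷ []) ∨_)
    (any-subseqs-pair (λ τ → orderIso (τ ++ [ v ]) (r₁ ∷ r₂ ∷ r₃ ∷ [])) s refl (λ _ → refl)
      -- Four or more entries fail the length test, but τ must be split before the length of τ ++
      -- [ v ] reduces.
      (λ where
        _ _ _ []      → refl
        _ _ _ (_ ∷ _) → refl)))

-- Values that may be appended

<ᵇ-true : ∀ {m n} → m < n → (m <ᵇ n) ≡ true
<ᵇ-true {m} {n} m<n = dec-true (m ℕ.<? n) m<n

<ᵇ-false : ∀ {m n} → n ≤ m → (m <ᵇ n) ≡ false
<ᵇ-false {m} {n} n≤m = dec-false (m ℕ.<? n) (ℕ.≤⇒≯ n≤m)

<ᵇ-false⁻ : ∀ {m n} → (m <ᵇ n) ≡ false → n ≤ m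
<ᵇ-false⁻ {m} {n} m≮ᵇn with m ℕ.<? n
... | yes m<n = ⊥-elim (Bool.not-¬ m≮ᵇn (<ᵇ-true m<n))
... | no  m≮n = ℕ.≮⇒≥ m≮n

-- The third comparison, b < v, follows by transitivity; likewise v < a for the pattern 210.
orderIso-102 : ∀ a b v → orderIso (a ∷ b ∷ v ∷ []) (1 ∷ 0 ∷ 2 ∷ []) ≡ (b <ᵇ a) ∧ (a <ᵇ v)
orderIso-102 a b v with ℕ.<-cmp a b
... | tri< a<b _ _ rewrite <ᵇ-true a<b | <ᵇ-false (ℕ.<⇒≤ a<b) = refl
... | tri≈ _ refl _ rewrite <ᵇ-false (ℕ.≤-refl {a}) = refl
... | tri> _ _ b<a rewrite <ᵇ-true b<a | <ᵇ-false (ℕ.<⇒≤ b<a) with ℕ.<-cmp a v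
...   | tri< a<v _ _ rewrite <ᵇ-true a<v | <ᵇ-false (ℕ.<⇒≤ a<v)
                           | <ᵇ-true (ℕ.<-trans b<a a<v) | <ᵇ-false (ℕ.<⇒≤ (ℕ.<-trans b<a a<v)) = refl
...   | tri≈ _ refl _ rewrite <ᵇ-false (ℕ.≤-refl {a}) = refl
...   | tri> _ _ v<a rewrite <ᵇ-true v<a | <ᵇ-false (ℕ.<⇒≤ v<a) = refl

orderIso-210 : ∀ a b v → orderIso (a ∷ b ∷ v ∷ []) (2 ∷ 1 ∷ 0 ∷ []) ≡ (b <ᵇ a) ∧ (v <ᵇ b)
orderIso-210 a b v with ℕ.<-cmp a b
... | tri< a<b _ _ rewrite <ᵇ-true a<b | <ᵇ-false (ℕ.<⇒≤ a<b) = refl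
... | tri≈ _ refl _ rewrite <ᵇ-false (ℕ.≤-refl {a}) = refl
... | tri> _ _ b<a rewrite <ᵇ-true b<a | <ᵇ-false (ℕ.<⇒≤ b<a) with ℕ.<-cmp v b
...   | tri< v<b _ _ rewrite <ᵇ-true v<b | <ᵇ-false (ℕ.<⇒≤ v<b)
                           | <ᵇ-true (ℕ.<-trans v<b b<a) | <ᵇ-false (ℕ.<⇒≤ (ℕ.<-trans v<b b<a)) = refl
...   | tri≈ _ refl _ rewrite <ᵇ-false (ℕ.≤-refl {v}) | <ᵇ-true b<a | <ᵇ-false (ℕ.<⇒≤ b<a) = refl
...   | tri> _ _ b<v rewrite <ᵇ-true b<v | <ᵇ-false (ℕ.<⇒≤ b<v) = Bool.∧-zeroʳ _

avoids : List ℕ → Bool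
avoids = avoidsAllᵇ ((1 ∷ 0 ∷ 2 ∷ []) ∷ (2 ∷ 1 ∷ 0 ∷ []) ∷ [])

creates102 creates210 : List ℕ → ℕ → Bool
creates102 s v = any (λ (a , b) → orderIso (a ∷ b ∷ v ∷ []) (1 ∷ 0 ∷ 2 ∷ [])) (pairs s)
creates210 s v = any (λ (a , b) → orderIso (a ∷ b ∷ v ∷ []) (2 ∷ 1 ∷ 0 ∷ [])) (pairs s)

admits : List ℕ → ℕ → Bool
admits s v = not (creates102 s v) ∧ not (creates210 s v)

avoids-snoc : ∀ s v → avoids (s ++ [ v ]) ≡ avoids s ∧ admits s v
avoids-snoc s v rewrite containsᵇ-snoc {1} {0} {2} s v | containsᵇ-snoc {2} {1} {0} s v =
  rearrange (containsᵇ s (1 ∷ 0 ∷ 2 ∷ [])) (creates102 s v) (containsᵇ s (2 ∷ 1 ∷ 0 ∷ [])) (creates210 s v)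
  where
  rearrange : ∀ a b c d →
    (if a ∨ b then false else true) ∧ ((if c ∨ d then false else true) ∧ true)
    ≡ ((if a then false else true) ∧ ((if c then false else true) ∧ true)) ∧ (not b ∧ not d)
  rearrange true  b     c     d     = refl
  rearrange false true  true  d     = refl
  rearrange false true  false d     = refl
  rearrange false false true  d     = refl
  rearrange false false false true  = refl
  rearrange false false false false = refl

Admissible : List ℕ → ℕ → Set
Admissible s v = ∀ {a b} → (a , b) ∈ pairs s → b < a → b ≤ v × v ≤ a

any-false : ∀ {A : Set} (p : A → Bool) xs → (∀ {x} → x ∈ xs → p x ≡ false) → any p xs ≡ false
any-false p []       p≡f = refl
any-false p (x ∷ xs) p≡f rewrite p≡f (here refl) = any-false p xs (λ x∈xs → p≡f (there x∈xs))

any-false⁻ : ∀ {A : Set} (p : A → Bool) xs → any p xs ≡ false → ∀ {x} → x ∈ xs → p x ≡ false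
any-false⁻ p (x ∷ xs) eq (here refl)  with p x
... | false = refl
any-false⁻ p (x ∷ xs) eq (there y∈xs) with p x
... | false = any-false⁻ p xs eq y∈xs

Admissible⇒admits : ∀ {s v} → Admissible s v → admits s v ≡ true
Admissible⇒admits {s} {v} ok = cong₂ (λ a b → not a ∧ not b)
  (any-false _ (pairs s) λ {(a , b)} ab∈ → trans (orderIso-102 a b v) (no-rise ab∈))
  (any-false _ (pairs s) λ {(a , b)} ab∈ → trans (orderIso-210 a b v) (no-fall ab∈))
  where
  no-rise : ∀ {a b} → (a , b) ∈ pairs s → (b <ᵇ a) ∧ (a <ᵇ v) ≡ false
  no-rise {a} {b} ab∈ with b ℕ.<? a
  ... | yes b<a = trans (cong ((b <ᵇ a) ∧_) (<ᵇ-false (proj₂ (ok ab∈ b<a)))) (Bool.∧-zeroʳ _)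
  ... | no  b≮a = cong (_∧ (a <ᵇ v)) (<ᵇ-false (ℕ.≮⇒≥ b≮a))
  no-fall : ∀ {a b} → (a , b) ∈ pairs s → (b <ᵇ a) ∧ (v <ᵇ b) ≡ false
  no-fall {a} {b} ab∈ with b ℕ.<? a
  ... | yes b<a = trans (cong ((b <ᵇ a) ∧_) (<ᵇ-false (proj₁ (ok ab∈ b<a)))) (Bool.∧-zeroʳ _)
  ... | no  b≮a = cong (_∧ (v <ᵇ b)) (<ᵇ-false (ℕ.≮⇒≥ b≮a))

admits⇒Admissible : ∀ {s v} → admits s v ≡ true → Admissible s v
admits⇒Admissible {s} {v} ok {a} {b} ab∈ b<a =
  <ᵇ-false⁻ (trans (cong (_∧ (v <ᵇ b)) (sym (<ᵇ-true b<a)))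
    (trans (sym (orderIso-210 a b v)) (any-false⁻ _ (pairs s) (proj₂ both) ab∈))) ,
  <ᵇ-false⁻ (trans (cong (_∧ (a <ᵇ v)) (sym (<ᵇ-true b<a)))
    (trans (sym (orderIso-102 a b v)) (any-false⁻ _ (pairs s) (proj₁ both) ab∈)))
  where
  split : ∀ a b → not a ∧ not b ≡ true → a ≡ false × b ≡ false
  split false false _ = refl , refl
  both = split (creates102 s v) (creates210 s v) ok

∈-pairs-snoc⁻ : ∀ {a b w} (s : List ℕ) → (a , b) ∈ pairs (s ++ [ w ]) → (a , b) ∈ pairs s ⊎ (a ∈ s × b ≡ w)
∈-pairs-snoc⁻ {w = w} (x ∷ s) ab∈ with ∈-++⁻ (map (x ,_) (s ++ [ w ])) ab∈
... | inj₂ ab∈′ with ∈-pairs-snoc⁻ s ab∈′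
...   | inj₁ ab∈″        = inj₁ (∈-++⁺ʳ (map (x ,_) s) ab∈″)
...   | inj₂ (a∈ , b≡w)  = inj₂ (there a∈ , b≡w)
∈-pairs-snoc⁻ {w = w} (x ∷ s) ab∈ | inj₁ ab∈′ with ∈-map⁻ (x ,_) ab∈′
... | b , b∈ , refl with ∈-++⁻ s b∈
...   | inj₁ b∈s         = inj₁ (∈-++⁺ˡ (∈-map⁺ (x ,_) b∈s))
...   | inj₂ (here b≡w)  = inj₂ (here refl , b≡w)

∈-pairs-snoc⁺ˡ : ∀ {p w} (s : List ℕ) → p ∈ pairs s → p ∈ pairs (s ++ [ w ])
∈-pairs-snoc⁺ˡ {w = w} (x ∷ s) p∈ with ∈-++⁻ (map (x ,_) s) p∈
... | inj₂ p∈′ = ∈-++⁺ʳ (map (x ,_) (s ++ [ w ])) (∈-pairs-snoc⁺ˡ s p∈′)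
... | inj₁ p∈′ with ∈-map⁻ (x ,_) p∈′
...   | b , b∈ , refl = ∈-++⁺ˡ (∈-map⁺ (x ,_) (∈-++⁺ˡ b∈))

∈-pairs-snoc⁺ʳ : ∀ {a w} (s : List ℕ) → a ∈ s → (a , w) ∈ pairs (s ++ [ w ])
∈-pairs-snoc⁺ʳ {w = w} (x ∷ s) (here refl) = ∈-++⁺ˡ (∈-map⁺ (x ,_) (∈-++⁺ʳ s (here refl)))
∈-pairs-snoc⁺ʳ {w = w} (x ∷ s) (there a∈)  = ∈-++⁺ʳ (map (x ,_) (s ++ [ w ])) (∈-pairs-snoc⁺ʳ s a∈)

Admissible-snoc⁻ : ∀ {s w v} → Admissible (s ++ [ w ]) v →
  Admissible s v × (∀ {a} → a ∈ s → w < a → w ≤ v × v ≤ a)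
Admissible-snoc⁻ {s} ok = (λ ab∈ → ok (∈-pairs-snoc⁺ˡ s ab∈)) , (λ a∈ → ok (∈-pairs-snoc⁺ʳ s a∈))

Admissible-snoc⁺ : ∀ {s w v} → Admissible s v → (∀ {a} → a ∈ s → w < a → w ≤ v × v ≤ a) →
  Admissible (s ++ [ w ]) v
Admissible-snoc⁺ {s} ok below ab∈ with ∈-pairs-snoc⁻ s ab∈
... | inj₁ ab∈s       = ok ab∈s
... | inj₂ (a∈ , refl) = below a∈

-- Summation over the tree of extensions

∑ : ℕ → (ℕ → ℤ) → ℤ
∑ = ∑ℤ.∑

extensions : ℕ → ℕ → List ℕ → ℤ
extensions zero    n s = + 1
extensions (suc l) n s = ∑ (suc n) (λ v → if admits s v then extensions l (suc n) (s ++ [ v ]) else + 0)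

sumℤ-++ : ∀ as bs → sumℤ (as ++ bs) ≡ sumℤ as ℤ.+ sumℤ bs
sumℤ-++ []       bs = sym (ℤ.+-identityˡ _)
sumℤ-++ (a ∷ as) bs = trans (cong (ℤ._+_ a) (sumℤ-++ as bs)) (sym (ℤ.+-assoc a _ _))

sumℤ-concatMap : ∀ {A B : Set} (φ : B → ℤ) (g : A → List B) xs →
  sumℤ (map φ (concatMap g xs)) ≡ sumℤ (map (λ x → sumℤ (map φ (g x))) xs)
sumℤ-concatMap φ g []       = refl
sumℤ-concatMap φ g (x ∷ xs) = begin
  sumℤ (map φ (g x ++ concatMap g xs))                        ≡⟨ cong sumℤ (map-++ φ (g x) (concatMap g xs)) ⟩
  sumℤ (map φ (g x) ++ map φ (concatMap g xs))                ≡⟨ sumℤ-++ (map φ (g x)) _ ⟩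
  sumℤ (map φ (g x)) ℤ.+ sumℤ (map φ (concatMap g xs))        ≡⟨ cong (ℤ._+_ (sumℤ (map φ (g x)))) (sumℤ-concatMap φ g xs) ⟩
  sumℤ (map (λ y → sumℤ (map φ (g y))) (x ∷ xs))              ∎

sumℤ-applyUpTo : ∀ (φ : ℕ → ℤ) m → sumℤ (applyUpTo φ m) ≡ ∑ m φ
sumℤ-applyUpTo φ zero    = refl
sumℤ-applyUpTo φ (suc m) = cong (ℤ._+_ (φ 0)) (sumℤ-applyUpTo (φ ∘ suc) m)

total : ℕ → ℕ → ℤ
total l n = sumℤ (map (λ s → if avoids s then extensions l n s else + 0) (invSeqs n))

-- A nonempty sequence is its prefix plus a last value, and it avoids only if its prefix does; so
-- one unit of length can be traded for one more extension step.
total-suc : ∀ l n → total l (suc n) ≡ total (suc l) n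
total-suc l n = begin
  total l (suc n)
    ≡⟨ sumℤ-concatMap φ (λ s → map (λ v → s ++ [ v ]) (upTo (suc n))) (invSeqs n) ⟩
  sumℤ (map (λ s → sumℤ (map φ (map (λ v → s ++ [ v ]) (upTo (suc n))))) (invSeqs n))
    ≡⟨ cong sumℤ (map-cong step (invSeqs n)) ⟩
  total (suc l) n ∎
  where
  φ : List ℕ → ℤ
  φ s = if avoids s then extensions l (suc n) s else + 0
  branch : ∀ s → ∑ (suc n) (λ v → if avoids s ∧ admits s v then extensions l (suc n) (s ++ [ v ]) else + 0)
    ≡ (if avoids s then extensions (suc l) n s else + 0)
  branch s with avoids s
  ... | true  = refl
  ... | false = ∑ℤ.∑-zero (suc n) (λ _ _ → refl)
  step : ∀ s → sumℤ (map φ (map (λ v → s ++ [ v ]) (upTo (suc n)))) ≡ (if avoids s then extensions (suc l) n s else + 0)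
  step s = begin
    sumℤ (map φ (map (λ v → s ++ [ v ]) (upTo (suc n))))
      ≡⟨ cong sumℤ (trans (sym (map-∘ {g = φ} {f = λ v → s ++ [ v ]} (upTo (suc n)))) (map-applyUpTo id (λ v → φ (s ++ [ v ])) (suc n))) ⟩
    sumℤ (applyUpTo (λ v → φ (s ++ [ v ])) (suc n))
      ≡⟨ sumℤ-applyUpTo (λ v → φ (s ++ [ v ])) (suc n) ⟩
    ∑ (suc n) (λ v → φ (s ++ [ v ]))
      ≡⟨ ∑ℤ.∑-cong (suc n) (λ v _ →
           cong (if_then extensions l (suc n) (s ++ [ v ]) else + 0) (avoids-snoc s v)) ⟩
    ∑ (suc n) (λ v → if avoids s ∧ admits s v then extensions l (suc n) (s ++ [ v ]) else + 0)
      ≡⟨ branch s ⟩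
    (if avoids s then extensions (suc l) n s else + 0) ∎

total-shift : ∀ n l → total l n ≡ extensions (n ℕ.+ l) 0 []
total-shift zero    l = ℤ.+-identityʳ _
total-shift (suc n) l = begin
  total l (suc n)                    ≡⟨ total-suc l n ⟩
  total (suc l) n                    ≡⟨ total-shift n (suc l) ⟩
  extensions (n ℕ.+ suc l) 0 []      ≡⟨ cong (λ k → extensions k 0 []) (ℕ.+-suc n l) ⟩
  extensions (suc (n ℕ.+ l)) 0 []    ∎

count≡extensions : ∀ n → + countAvoiders ((1 ∷ 0 ∷ 2 ∷ []) ∷ (2 ∷ 1 ∷ 0 ∷ []) ∷ []) n ≡ extensions n 0 []
count≡extensions n = begin
  + length (filter (λ s → avoids s Bool.≟ true) (invSeqs n))   ≡⟨ length-filter (invSeqs n) ⟩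
  total 0 n                                                   ≡⟨ total-shift n 0 ⟩
  extensions (n ℕ.+ 0) 0 []                                   ≡⟨ cong (λ k → extensions k 0 []) (ℕ.+-identityʳ n) ⟩
  extensions n 0 []                                           ∎
  where
  length-filter : ∀ xs → + length (filter (λ s → avoids s Bool.≟ true) xs)
    ≡ sumℤ (map (λ s → if avoids s then + 1 else + 0) xs)
  length-filter []       = refl
  length-filter (x ∷ xs) with avoids x
  ... | true  = cong (ℤ._+_ (+ 1)) (length-filter xs)
  ... | false = trans (length-filter xs) (sym (ℤ.+-identityˡ _))

-- Continuations of an avoiding prefix

∈-snoc⁺ : ∀ {w} (s : List ℕ) → w ∈ s ++ [ w ]
∈-snoc⁺ s = ∈-++⁺ʳ s (here refl)

∈-snoc⁻ : ∀ {e w} (s : List ℕ) → e ∈ s ++ [ w ] → e ∈ s ⊎ e ≡ w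
∈-snoc⁻ s e∈ with ∈-++⁻ s e∈
... | inj₁ e∈s         = inj₁ e∈s
... | inj₂ (here e≡w)  = inj₂ e≡w

if-admissible : ∀ s v {a} → Admissible s v → (if admits s v then a else + 0) ≡ a
if-admissible s v {a} ok = cong (λ b → if b then a else + 0) (Admissible⇒admits {s} ok)

if-inadmissible : ∀ s v {a} → ¬ Admissible s v → (if admits s v then a else + 0) ≡ + 0
if-inadmissible s v ¬ok with admits s v in eq
... | true  = ⊥-elim (¬ok (admits⇒Admissible {s} eq))
... | false = refl

record Window (s : List ℕ) (lo hi : ℕ) : Set where
  field
    bounds : ∀ {v} → Admissible s v → lo ≤ v × v ≤ hi
    inside : ∀ {v} → lo ≤ v → v ≤ hi → Admissible s v

-- Since hi ≤ n, the bound on the values of an inversion sequence does not cut into the window; the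
-- values outside contribute 0.
extensions-window : ∀ l n {s lo hi} → Window s lo hi → lo ≤ hi → hi ≤ n →
  extensions (suc l) n s ≡ ∑ (suc (hi ∸ lo)) (λ j → extensions l (suc n) (s ++ [ lo ℕ.+ j ]))
extensions-window l n {s} {lo} {hi} window lo≤hi hi≤n = begin
  ∑ (suc n) e
    ≡⟨ cong (λ k → ∑ k e) length-split ⟨
  ∑ (lo ℕ.+ (suc (hi ∸ lo) ℕ.+ (n ∸ hi))) e
    ≡⟨ ∑ℤ.∑-split lo _ e ⟩
  ∑ lo e ℤ.+ ∑ (suc (hi ∸ lo) ℕ.+ (n ∸ hi)) (λ j → e (lo ℕ.+ j))
    ≡⟨ cong₂ ℤ._+_ (∑ℤ.∑-zero lo (λ v v<lo → if-inadmissible s v (λ ok → ℕ.<⇒≱ v<lo (proj₁ (bounds ok)))))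
         (∑ℤ.∑-split (suc (hi ∸ lo)) (n ∸ hi) (λ j → e (lo ℕ.+ j))) ⟩
  + 0 ℤ.+ (∑ (suc (hi ∸ lo)) (λ j → e (lo ℕ.+ j)) ℤ.+ ∑ (n ∸ hi) (λ i → e (lo ℕ.+ (suc (hi ∸ lo) ℕ.+ i))))
    ≡⟨ trans (ℤ.+-identityˡ _) (cong (ℤ._+_ (∑ (suc (hi ∸ lo)) (λ j → e (lo ℕ.+ j))))
         (∑ℤ.∑-zero (n ∸ hi) (λ i _ → if-inadmissible s _ (λ ok → ℕ.<⇒≱ (beyond i) (proj₂ (bounds ok)))))) ⟩
  ∑ (suc (hi ∸ lo)) (λ j → e (lo ℕ.+ j)) ℤ.+ + 0
    ≡⟨ ℤ.+-identityʳ _ ⟩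
  ∑ (suc (hi ∸ lo)) (λ j → e (lo ℕ.+ j))
    ≡⟨ ∑ℤ.∑-cong (suc (hi ∸ lo)) {b = λ j → extensions l (suc n) (s ++ [ lo ℕ.+ j ])} (λ j j≤ →
         if-admissible s (lo ℕ.+ j) (inside (ℕ.m≤m+n lo j) (lo+j≤hi (ℕ.s≤s⁻¹ j≤)))) ⟩
  ∑ (suc (hi ∸ lo)) (λ j → extensions l (suc n) (s ++ [ lo ℕ.+ j ])) ∎
  where
  open Window window
  e : ℕ → ℤ
  e v = if admits s v then extensions l (suc n) (s ++ [ v ]) else + 0
  lo+j≤hi : ∀ {j} → j ≤ hi ∸ lo → lo ℕ.+ j ≤ hi
  lo+j≤hi j≤ = subst (lo ℕ.+ _ ≤_) (ℕ.m+[n∸m]≡n lo≤hi) (ℕ.+-monoʳ-≤ lo j≤)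
  past : ∀ i → lo ℕ.+ (suc (hi ∸ lo) ℕ.+ i) ≡ suc (hi ℕ.+ i)
  past i = trans (ℕ.+-suc lo (hi ∸ lo ℕ.+ i))
    (cong suc (trans (sym (ℕ.+-assoc lo (hi ∸ lo) i)) (cong (ℕ._+ i) (ℕ.m+[n∸m]≡n lo≤hi))))
  beyond : ∀ i → hi < lo ℕ.+ (suc (hi ∸ lo) ℕ.+ i)
  beyond i = subst (hi <_) (sym (past i)) (s≤s (ℕ.m≤m+n hi i))
  length-split : lo ℕ.+ (suc (hi ∸ lo) ℕ.+ (n ∸ hi)) ≡ suc n
  length-split = trans (past (n ∸ hi)) (cong suc (ℕ.m+[n∸m]≡n hi≤n))

-- A larger earlier entry e makes (e , w) a descent, which raises the lower end to w; all such
-- entries are at least hi, so the upper end stays.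
window-snoc : ∀ {s lo hi w} → Window s lo hi → lo ≤ w → (∀ {e} → e ∈ s → w < e → hi ≤ e) →
  (∃ λ e → e ∈ s × w < e) → Window (s ++ [ w ]) w hi
window-snoc {s} {w = w} window lo≤w hi≤ (e , e∈ , w<e) = record
  { bounds = λ ok → let ok-s , below = Admissible-snoc⁻ {s} {w} ok in proj₁ (below e∈ w<e) , proj₂ (bounds ok-s)
  ; inside = λ w≤v v≤hi → Admissible-snoc⁺ {s} {w} (inside (ℕ.≤-trans lo≤w w≤v) v≤hi)
      (λ a∈ w<a → w≤v , ℕ.≤-trans v≤hi (hi≤ a∈ w<a))
  }
  where open Window window

-- `above` supplies an entry larger than every admissible value, so that each choice, even hi
-- itself, raises the lower end and the continuation is weakly increasing.
record InGap (s : List ℕ) (lo hi : ℕ) : Set where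
  field
    window : Window s lo hi
    above  : ∃ λ e → e ∈ s × hi < e
    empty  : ∀ {e} → e ∈ s → e ≤ lo ⊎ hi ≤ e

beyond-gap : ∀ {lo hi w e} → lo ≤ w → e ≤ lo ⊎ hi ≤ e → w < e → hi ≤ e
beyond-gap lo≤w (inj₁ e≤lo) w<e = ⊥-elim (ℕ.<⇒≱ w<e (ℕ.≤-trans e≤lo lo≤w))
beyond-gap lo≤w (inj₂ hi≤e) w<e = hi≤e

empty-snoc : ∀ {s lo hi w} → lo ≤ w → (∀ {e} → e ∈ s → e ≤ lo ⊎ hi ≤ e) →
  ∀ {e} → e ∈ s ++ [ w ] → e ≤ w ⊎ hi ≤ e
empty-snoc {s} lo≤w empty e∈ with ∈-snoc⁻ s e∈
... | inj₂ refl = inj₁ ℕ.≤-refl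
... | inj₁ e∈s with empty e∈s
...   | inj₁ e≤lo = inj₁ (ℕ.≤-trans e≤lo lo≤w)
...   | inj₂ hi≤e = inj₂ hi≤e

InGap-snoc : ∀ {s lo hi w} → InGap s lo hi → lo ≤ w → w ≤ hi → InGap (s ++ [ w ]) w hi
InGap-snoc gapped lo≤w w≤hi = record
  { window = window-snoc window lo≤w (λ e∈ → beyond-gap lo≤w (empty e∈))
      (let e , e∈ , hi<e = above in e , e∈ , ℕ.≤-<-trans w≤hi hi<e)
  ; above  = let e , e∈ , hi<e = above in e , ∈-++⁺ˡ e∈ , hi<e
  ; empty  = empty-snoc lo≤w empty
  }
  where open InGap gapped

extensions-InGap : ∀ l n {s lo hi} → InGap s lo hi → lo ≤ hi → hi ≤ n → extensions l n s ≡ gap (hi ∸ lo) l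
extensions-InGap zero    n gapped lo≤hi hi≤n = refl
extensions-InGap (suc l) n {s} {lo} {hi} gapped lo≤hi hi≤n = trans
  (extensions-window l n (InGap.window gapped) lo≤hi hi≤n)
  (∑ℤ.∑-cong (suc (hi ∸ lo)) λ j j≤ →
    let w≤hi = subst (lo ℕ.+ j ≤_) (ℕ.m+[n∸m]≡n lo≤hi) (ℕ.+-monoʳ-≤ lo (ℕ.s≤s⁻¹ j≤)) in trans
    (extensions-InGap l (suc n) (InGap-snoc gapped (ℕ.m≤m+n lo j) w≤hi) w≤hi (ℕ.m≤n⇒m≤1+n hi≤n))
    (cong (λ d → gap d l) (sym (ℕ.∸-+-assoc hi lo j))))

-- Here hi is the maximum: by `bound`, appending hi creates no descent and leaves the window as it
-- is.
record InTopGap (s : List ℕ) (lo hi : ℕ) : Set where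
  field
    window : Window s lo hi
    top    : hi ∈ s
    bound  : ∀ {e} → e ∈ s → e ≤ hi
    empty  : ∀ {e} → e ∈ s → e ≤ lo ⊎ hi ≤ e

bound-snoc : ∀ {s hi w} → (∀ {e} → e ∈ s → e ≤ hi) → w ≤ hi → ∀ {e} → e ∈ s ++ [ w ] → e ≤ hi
bound-snoc {s} bound w≤hi e∈ with ∈-snoc⁻ s e∈
... | inj₁ e∈s  = bound e∈s
... | inj₂ refl = w≤hi

InTopGap-snoc-below : ∀ {s lo hi w} → InTopGap s lo hi → lo ≤ w → w < hi → InTopGap (s ++ [ w ]) w hi
InTopGap-snoc-below {hi = hi} gapped lo≤w w<hi = record
  { window = window-snoc window lo≤w (λ e∈ → beyond-gap lo≤w (empty e∈)) (hi , top , w<hi)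
  ; top    = ∈-++⁺ˡ top
  ; bound  = bound-snoc bound (ℕ.<⇒≤ w<hi)
  ; empty  = empty-snoc lo≤w empty
  }
  where open InTopGap gapped

InTopGap-snoc-top : ∀ {s lo hi} → InTopGap s lo hi → InTopGap (s ++ [ hi ]) lo hi
InTopGap-snoc-top {s} {lo} {hi} gapped = record
  { window = record
    { bounds = λ ok → bounds (proj₁ (Admissible-snoc⁻ {s} {hi} ok))
    ; inside = λ lo≤v v≤hi → Admissible-snoc⁺ {s} {hi} (inside lo≤v v≤hi)
        (λ a∈ hi<a → ⊥-elim (ℕ.<⇒≱ hi<a (bound a∈)))
    }
  ; top    = ∈-++⁺ˡ top
  ; bound  = bound-snoc bound ℕ.≤-refl
  ; empty  = empty′
  }
  where
  open InTopGap gapped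
  open Window window
  empty′ : ∀ {e} → e ∈ s ++ [ hi ] → e ≤ lo ⊎ hi ≤ e
  empty′ e∈ with ∈-snoc⁻ s e∈
  ... | inj₁ e∈s  = empty e∈s
  ... | inj₂ refl = inj₂ ℕ.≤-refl

extensions-InTopGap : ∀ l n {s lo hi} → InTopGap s lo hi → lo ≤ hi → hi ≤ n → extensions l n s ≡ topGap (hi ∸ lo) l
extensions-InTopGap zero    n gapped lo≤hi hi≤n = refl
extensions-InTopGap (suc l) n {s} {lo} {hi} gapped lo≤hi hi≤n = begin
  extensions (suc l) n s
    ≡⟨ extensions-window l n (InTopGap.window gapped) lo≤hi hi≤n ⟩
  ∑ (suc (hi ∸ lo)) e
    -- The last summand is the copy of the maximum, which keeps the width; `topGap` lists it first.
    ≡⟨ ∑ℤ.∑-last (hi ∸ lo) e ⟩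
  ∑ (hi ∸ lo) e ℤ.+ e (hi ∸ lo)
    ≡⟨ ℤ.+-comm (∑ (hi ∸ lo) e) (e (hi ∸ lo)) ⟩
  e (hi ∸ lo) ℤ.+ ∑ (hi ∸ lo) e
    ≡⟨ cong₂ ℤ._+_
         (trans (cong (λ w → extensions l (suc n) (s ++ [ w ])) (ℕ.m+[n∸m]≡n lo≤hi))
           (extensions-InTopGap l (suc n) (InTopGap-snoc-top gapped) lo≤hi (ℕ.m≤n⇒m≤1+n hi≤n)))
         (∑ℤ.∑-cong (hi ∸ lo) below) ⟩
  topGap (hi ∸ lo) (suc l) ∎
  where
  e : ℕ → ℤ
  e j = extensions l (suc n) (s ++ [ lo ℕ.+ j ])
  below : ∀ j → j < hi ∸ lo → e j ≡ topGap (hi ∸ lo ∸ j) l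
  below j j< = trans
    (extensions-InTopGap l (suc n) (InTopGap-snoc-below gapped (ℕ.m≤m+n lo j) w<hi) (ℕ.<⇒≤ w<hi) (ℕ.m≤n⇒m≤1+n hi≤n))
    (cong (λ d → topGap d l) (sym (ℕ.∸-+-assoc hi lo j)))
    where
    w<hi : lo ℕ.+ j < hi
    w<hi = subst (lo ℕ.+ j <_) (ℕ.m+[n∸m]≡n lo≤hi) (ℕ.+-monoʳ-< lo j<)

-- s is weakly increasing, p and p + g are its two largest distinct values (with g = 0 for a constant s), and
-- next y is the least entry above y.
record Rising (s : List ℕ) (p g : ℕ) (next : ℕ → ℕ) : Set where
  field
    sorted     : ∀ {a b} → (a , b) ∈ pairs s → a ≤ b
    top        : p ℕ.+ g ∈ s
    bound      : ∀ {e} → e ∈ s → e ≤ p ℕ.+ g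
    empty      : ∀ {e} → e ∈ s → e ≤ p ⊎ p ℕ.+ g ≤ e
    next-∈     : ∀ {y} → y < p → next y ∈ s
    next-<     : ∀ {y} → y < p → next y < p ℕ.+ g
    <-next     : ∀ {y} → y < p → y < next y
    next-empty : ∀ {y} → y < p → ∀ {e} → e ∈ s → e ≤ y ⊎ next y ≤ e

  admissible : ∀ {v} → Admissible s v
  admissible ab∈ b<a = ⊥-elim (ℕ.<⇒≱ b<a (sorted ab∈))

  sorted-snoc : ∀ {w} → p ℕ.+ g ≤ w → ∀ {a b} → (a , b) ∈ pairs (s ++ [ w ]) → a ≤ b
  sorted-snoc m≤w ab∈ with ∈-pairs-snoc⁻ s ab∈
  ... | inj₁ ab∈s        = sorted ab∈s
  ... | inj₂ (a∈ , refl) = ℕ.≤-trans (bound a∈) m≤w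

  window : ∀ {y hi} → y < hi → hi ∈ s → (∀ {e} → e ∈ s → e ≤ y ⊎ hi ≤ e) → Window (s ++ [ y ]) y hi
  window {y} y<hi hi∈ gap-empty = record
    { bounds = λ ok → proj₂ (Admissible-snoc⁻ {s} {y} ok) hi∈ y<hi
    ; inside = λ y≤v v≤hi → Admissible-snoc⁺ {s} {y} admissible
        (λ a∈ y<a → y≤v , ℕ.≤-trans v≤hi (beyond-gap ℕ.≤-refl (gap-empty a∈) y<a))
    }

  descend : ∀ {y} → y < p → InGap (s ++ [ y ]) y (next y)
  descend y<p = record
    { window = window (<-next y<p) (next-∈ y<p) (next-empty y<p)
    ; above  = p ℕ.+ g , ∈-++⁺ˡ top , next-< y<p
    ; empty  = empty-snoc ℕ.≤-refl (next-empty y<p)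
    }

  descend-top : ∀ {y} → p ≤ y → y < p ℕ.+ g → InTopGap (s ++ [ y ]) y (p ℕ.+ g)
  descend-top {y} p≤y y<m = record
    { window = window y<m top gap-empty
    ; top    = ∈-++⁺ˡ top
    ; bound  = bound-snoc bound (ℕ.<⇒≤ y<m)
    ; empty  = empty-snoc ℕ.≤-refl gap-empty
    }
    where
    gap-empty : ∀ {e} → e ∈ s → e ≤ y ⊎ p ℕ.+ g ≤ e
    gap-empty e∈ with empty e∈
    ... | inj₁ e≤p = inj₁ (ℕ.≤-trans e≤p p≤y)
    ... | inj₂ m≤e = inj₂ m≤e

  stay : Rising (s ++ [ p ℕ.+ g ]) p g next
  stay = record
    { sorted     = sorted-snoc ℕ.≤-refl
    ; top        = ∈-++⁺ˡ top
    ; bound      = bound-snoc bound ℕ.≤-refl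
    ; empty      = λ e∈ → old-or-top empty (inj₂ ℕ.≤-refl) (∈-snoc⁻ s e∈)
    ; next-∈     = λ y<p → ∈-++⁺ˡ (next-∈ y<p)
    ; next-<     = next-<
    ; <-next     = <-next
    ; next-empty = λ y<p e∈ → old-or-top (next-empty y<p) (inj₂ (ℕ.<⇒≤ (next-< y<p))) (∈-snoc⁻ s e∈)
    }
    where
    old-or-top : ∀ {P : ℕ → Set} → (∀ {e} → e ∈ s → P e) → P (p ℕ.+ g) → ∀ {e} → e ∈ s ⊎ e ≡ p ℕ.+ g → P e
    old-or-top old new (inj₁ e∈s)  = old e∈s
    old-or-top old new (inj₂ refl) = new

-- After a jump the former maximum m is the least entry above each y in [p , m); lower values keep
-- their successor.
extend-next : ℕ → ℕ → (ℕ → ℕ) → ℕ → ℕ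
extend-next p m next y = if y <ᵇ p then next y else m

extend-next-< : ∀ {p m next y} → y < p → extend-next p m next y ≡ next y
extend-next-< {m = m} {next} {y} y<p = cong (if_then next y else m) (<ᵇ-true y<p)

extend-next-≥ : ∀ {p m next y} → p ≤ y → extend-next p m next y ≡ m
extend-next-≥ {m = m} {next} {y} p≤y = cong (if_then next y else m) (<ᵇ-false p≤y)

jump : ∀ {s p g next} → Rising s p g next → ∀ j →
  Rising (s ++ [ p ℕ.+ g ℕ.+ suc j ]) (p ℕ.+ g) (suc j) (extend-next p (p ℕ.+ g) next)
jump {s} {p} {g} {next} r j = record
  { sorted     = sorted-snoc (ℕ.<⇒≤ m<w)
  ; top        = ∈-snoc⁺ s
  ; bound      = bound-snoc (λ e∈ → ℕ.≤-trans (bound e∈) (ℕ.<⇒≤ m<w)) ℕ.≤-refl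
  ; empty      = λ e∈ → empty′ (∈-snoc⁻ s e∈)
  ; next-∈     = λ {y} y<m → ∈-++⁺ˡ (proj₁ (next′ y y<m))
  ; next-<     = λ {y} y<m → ℕ.≤-<-trans (proj₁ (proj₂ (next′ y y<m))) m<w
  ; <-next     = λ {y} y<m → proj₁ (proj₂ (proj₂ (next′ y y<m)))
  ; next-empty = λ {y} y<m e∈ → next-empty′ y y<m (∈-snoc⁻ s e∈)
  }
  where
  open Rising r
  m = p ℕ.+ g
  m<w : m < m ℕ.+ suc j
  m<w = ℕ.m<m+n m (s≤s z≤n)
  empty′ : ∀ {e} → e ∈ s ⊎ e ≡ m ℕ.+ suc j → e ≤ m ⊎ m ℕ.+ suc j ≤ e
  empty′ (inj₁ e∈s)  = inj₁ (bound e∈s)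
  empty′ (inj₂ refl) = inj₂ ℕ.≤-refl
  next′ : ∀ y → y < m → let n = extend-next p m next y in
    n ∈ s × n ≤ m × y < n × (∀ {e} → e ∈ s → e ≤ y ⊎ n ≤ e)
  next′ y y<m with y ℕ.<? p
  ... | yes y<p rewrite extend-next-< {p} {m} {next} y<p =
    next-∈ y<p , ℕ.<⇒≤ (next-< y<p) , <-next y<p , next-empty y<p
  ... | no  y≮p rewrite extend-next-≥ {p} {m} {next} (ℕ.≮⇒≥ y≮p) =
    top , ℕ.≤-refl , y<m , (λ e∈ → [p≤y] (empty e∈))
    where
    [p≤y] : ∀ {e} → e ≤ p ⊎ m ≤ e → e ≤ y ⊎ m ≤ e
    [p≤y] (inj₁ e≤p) = inj₁ (ℕ.≤-trans e≤p (ℕ.≮⇒≥ y≮p))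
    [p≤y] (inj₂ m≤e) = inj₂ m≤e
  next-empty′ : ∀ y → y < m → ∀ {e} → e ∈ s ⊎ e ≡ m ℕ.+ suc j → e ≤ y ⊎ extend-next p m next y ≤ e
  next-empty′ y y<m (inj₁ e∈s)  = proj₂ (proj₂ (proj₂ (next′ y y<m))) e∈s
  next-empty′ y y<m (inj₂ refl) = inj₂ (ℕ.≤-trans (proj₁ (proj₂ (next′ y y<m))) (ℕ.<⇒≤ m<w))

-- The next value v falls below p (a lower gap), in [p , p + g) (the top gap), at the maximum (h
-- grows by one), or above it. Raising the maximum by j + 1 while the length grows by 1 changes h to
-- h - j and turns the top gap into a lower one, which adds `gaps g` to r.
extensions-Rising : ∀ l h {s p g next r} → Rising s p g next → r ≗ (λ k → ∑ p (λ y → gap (next y ∸ y) k)) →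
  extensions l (p ℕ.+ g ℕ.+ h) s ≡ climb l h g r
extensions-Rising zero    h rising r≗ = refl
extensions-Rising (suc l) h {s} {p} {g} {next} {r} rising r≗ = begin
  extensions (suc l) n s
    ≡⟨ ∑ℤ.∑-cong (suc n) {b = e} (λ v _ → if-admissible s v admissible) ⟩
  ∑ (suc n) e
    ≡⟨ cong (λ k → ∑ k e) (trans (sym (ℕ.+-suc (p ℕ.+ g) h)) (ℕ.+-assoc p g (suc h))) ⟩
  ∑ (p ℕ.+ (g ℕ.+ suc h)) e
    ≡⟨ trans (∑ℤ.∑-split p (g ℕ.+ suc h) e) (cong (ℤ._+_ (∑ p e)) (∑ℤ.∑-split g (suc h) (λ i → e (p ℕ.+ i)))) ⟩
  ∑ p e ℤ.+ (∑ g (λ i → e (p ℕ.+ i)) ℤ.+ ∑ (suc h) (λ i → e (p ℕ.+ (g ℕ.+ i))))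
    ≡⟨ ℤ.+-assoc (∑ p e) _ _ ⟨
  ∑ p e ℤ.+ ∑ g (λ i → e (p ℕ.+ i)) ℤ.+ ∑ (suc h) (λ i → e (p ℕ.+ (g ℕ.+ i)))
    ≡⟨ cong₂ ℤ._+_ (cong₂ ℤ._+_ lower-gaps top-gap) (cong₂ ℤ._+_ same (∑ℤ.∑-cong h higher)) ⟩
  climb (suc l) h g r ∎
  where
  open Rising rising
  n = p ℕ.+ g ℕ.+ h
  e : ℕ → ℤ
  e v = extensions l (suc n) (s ++ [ v ])
  m≤suc-n : p ℕ.+ g ≤ suc n
  m≤suc-n = ℕ.m≤n⇒m≤1+n (ℕ.m≤m+n (p ℕ.+ g) h)
  lower-gaps : ∑ p e ≡ r l
  lower-gaps = trans
    (∑ℤ.∑-cong p (λ y y<p → extensions-InGap l (suc n) (descend y<p) (ℕ.<⇒≤ (<-next y<p))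
      (ℕ.≤-trans (ℕ.<⇒≤ (next-< y<p)) m≤suc-n)))
    (sym (r≗ l))
  top-gap : ∑ g (λ i → e (p ℕ.+ i)) ≡ topGaps g l
  top-gap = ∑ℤ.∑-cong g λ i i<g → let y<m = ℕ.+-monoʳ-< p i<g in trans
    (extensions-InTopGap l (suc n) (descend-top (ℕ.m≤m+n p i) y<m) (ℕ.<⇒≤ y<m) m≤suc-n)
    (cong (λ d → topGap d l) (ℕ.[m+n]∸[m+o]≡n∸o p g i))
  same : e (p ℕ.+ (g ℕ.+ 0)) ≡ climb l (suc h) g r
  same = trans
    (cong₂ (λ k v → extensions l k (s ++ [ v ])) (sym (ℕ.+-suc (p ℕ.+ g) h)) (cong (p ℕ.+_) (ℕ.+-identityʳ g)))
    (extensions-Rising l (suc h) stay r≗)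
  r⊕gaps : (r ⊕ gaps g) ≗ (λ k → ∑ (p ℕ.+ g) (λ y → gap (extend-next p (p ℕ.+ g) next y ∸ y) k))
  r⊕gaps k = sym (trans (∑ℤ.∑-split p g (λ y → gap (extend-next p (p ℕ.+ g) next y ∸ y) k)) (cong₂ ℤ._+_
    (trans (∑ℤ.∑-cong p (λ y y<p → cong (λ z → gap (z ∸ y) k) (extend-next-< {next = next} y<p))) (sym (r≗ k)))
    (∑ℤ.∑-cong g (λ i _ → cong (λ d → gap d k) (trans
      (cong (_∸ (p ℕ.+ i)) (extend-next-≥ {next = next} (ℕ.m≤m+n p i))) (ℕ.[m+n]∸[m+o]≡n∸o p g i))))))
  higher : ∀ j → j < h → e (p ℕ.+ (g ℕ.+ suc j)) ≡ climb l (h ∸ j) (suc j) (r ⊕ gaps g)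
  higher j j<h = trans
    (cong₂ (λ k v → extensions l k (s ++ [ v ]))
      (sym (trans (ℕ.+-assoc (p ℕ.+ g) (suc j) (h ∸ j))
        (trans (ℕ.+-suc (p ℕ.+ g) (j ℕ.+ (h ∸ j))) (cong (λ i → suc (p ℕ.+ g ℕ.+ i)) (ℕ.m+[n∸m]≡n (ℕ.<⇒≤ j<h))))))
      (sym (ℕ.+-assoc p g (suc j))))
    (extensions-Rising l (h ∸ j) (jump rising j) r⊕gaps)

extensions≡climb : ∀ l → extensions (suc l) 0 [] ≡ climb l 1 0 (λ _ → + 0)
extensions≡climb l = trans (ℤ.+-identityʳ _) (extensions-Rising l 1 start (λ _ → refl))
  where
  -- As p = 0, no y lies below it: `next` is arbitrary and the sum defining r is empty.
  start : Rising [ 0 ] 0 0 (λ y → y)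
  start = record
    { sorted     = λ ()
    ; top        = here refl
    ; bound      = λ where (here refl) → z≤n
    ; empty      = λ _ → inj₂ z≤n
    ; next-∈     = λ ()
    ; next-<     = λ ()
    ; <-next     = λ ()
    ; next-empty = λ ()
    }

theorem25 : (S : Series) → S 0 ≡ + 1 → (∀ n → (S ⊛ S) n ≡ poly (+ 1 ∷ -[1+ 3 ] ∷ []) n) →
    ∀ n →
    (poly (+ 0 ∷ + 0 ∷ + 0 ∷ + 2 ∷ []) ⊛ poly (-[1+ 0 ] ∷ + 4 ∷ []) ⊛ poly (-[1+ 0 ] ∷ + 1 ∷ []) ⊛ poly (-[1+ 0 ] ∷ + 1 ∷ [])
    ⊛ genFun ((1 ∷ 0 ∷ 2 ∷ []) ∷ (2 ∷ 1 ∷ 0 ∷ []) ∷ [])) n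
    ≡
    (poly (-[1+ 0 ] ∷ + 4 ∷ []) ⊛ poly (+ 1 ∷ -[1+ 8 ] ∷ + 25 ∷ -[1+ 21 ] ∷ + 4 ∷ [])
    ⊖ poly (-[1+ 0 ] ∷ + 2 ∷ []) ⊛ poly (+ 1 ∷ -[1+ 4 ] ∷ + 1 ∷ []) ⊛ poly (+ 1 ∷ -[1+ 3 ] ∷ + 2 ∷ []) ⊛ S) n
theorem25 = climb-closed-form (genFun ((1 ∷ 0 ∷ 2 ∷ []) ∷ (2 ∷ 1 ∷ 0 ∷ []) ∷ [])) refl (λ l → trans (count≡extensions (suc l)) (extensions≡climb l))
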